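{- Let $k\in\mathbb{N}$ and $A\in\mathbb{S}(k)$. For every $\varepsilon>0$ there exists $\delta>0$ such that the following holds for every $n\ge k$. If $\pi\in\mathbb{S}(n)$ is a permutation with $t(A,\pi)<\delta$, then there exists a permutation $\tilde\pi\in\mathbb{S}(n)$ which is $A$-avoiding and satisfies $$\sum_{i=1}^n|\pi(i)-\tilde\pi(i)|<\varepsilon n^2.$$
   Context: $[n]=\{1,\dots,n\}$ and $\mathbb{S}(n)$ is the set of all permutations (bijections $[n]\to[n]$). For $\pi\in\mathbb{S}(n)$, $k\in[n]$, $A\in\mathbb{S}(k)$ and a $k$-element subset $K\subset[n]$, we say $K$ induces the pattern $A$ in $\pi$ if for all $i,j\in[k]$: $A(i)<A(j)$ if and only if the image under $\pi$ of the $i$th smallest element of $K$ is smaller than the image under $\pi$ of the $j$th smallest element of $K$. The density $t(A,\pi)$ is the proportion of $k$-element subsets of $[n]$ (among all $\binom{n}{k}$ of them) that induce $A$ in $\pi$. $\pi$ is $A$-avoiding if $t(A,\pi)=0$. -}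

module Defs where

open import Algebra.Properties.Monoid.Sum using (sum-syntax)
open import Data.Fin using (Fin; zero; suc; toℕ; cast; _<_)
open import Data.Fin.Permutation using (Permutation′; _⟨$⟩ʳ_)
open import Data.Fin.Properties using (_<?_; all?)
open import Data.Fin.Subset using (Subset; inside; outside; ∣_∣)
open import Data.Integer using (+_)
open import Data.List using (List; []; _∷_; _++_; map; filter; length)
open import Data.Nat as ℕ using (ℕ; zero; suc; _+_; _≤_; z≤n; s≤s; NonZero; ∣_-_∣)
open import Data.Nat.Combinatorics using (_C_; nCk+nC[k+1]≡[n+1]C[k+1])
open import Data.Nat.Properties using (+-0-monoid; ≤-trans; m≤m+n; ≤-reflexive; _≟_)
open import Data.Product using (Σ-syntax; _,_)
open import Data.Rational using (ℚ; 0ℚ; _/_)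
open import Data.Vec using ([]; _∷_)
open import Function.Bundles using (_⇔_; mk⇔; Equivalence)
open import Relation.Binary.PropositionalEquality using (_≡_; refl; sym)
open import Relation.Nullary using (Dec; yes; no)
open import Relation.Nullary.Decidable using (map′; _×-dec_; _→-dec_)

private
  variable
    k n : ℕ

-- `nthSmallest K i` is the element of K with exactly i elements of K below it;
-- ranks start at 0.
nthSmallest : (K : Subset n) → Fin ∣ K ∣ → Fin n
nthSmallest (inside  ∷ K) zero    = zero
nthSmallest (inside  ∷ K) (suc i) = suc (nthSmallest K i)
nthSmallest (outside ∷ K) i       = suc (nthSmallest K i)

-- The requirement that K has k elements is part of the predicate.
Induces : Permutation′ k → Permutation′ n → Subset n → Set
Induces {k} A π K =
  Σ[ ∣K∣≡k ∈ ∣ K ∣ ≡ k ]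
    let elem = λ (i : Fin k) → nthSmallest K (cast (sym ∣K∣≡k) i) in
    ∀ i j → (A ⟨$⟩ʳ i < A ⟨$⟩ʳ j) ⇔ (π ⟨$⟩ʳ elem i < π ⟨$⟩ʳ elem j)

_⇔-dec_ : {P Q : Set} → Dec P → Dec Q → Dec (P ⇔ Q)
p? ⇔-dec q? = map′ (λ (f , g) → mk⇔ f g)
                   (λ e → Equivalence.to e , Equivalence.from e)
                   ((p? →-dec q?) ×-dec (q? →-dec p?))

induces? : (A : Permutation′ k) (π : Permutation′ n) (K : Subset n) → Dec (Induces A π K)
induces? {k} A π K with ∣ K ∣ ≟ k
... | no  ∣K∣≢k = no λ (∣K∣≡k , _) → ∣K∣≢k ∣K∣≡k
... | yes ∣K∣≡k = map′ (∣K∣≡k ,_) (λ (_ , h) → h)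
                    (all? λ i → all? λ j → (_ <? _) ⇔-dec (_ <? _))

subsets : ∀ n → List (Subset n)
subsets zero    = [] ∷ []
subsets (suc n) = map (inside ∷_) (subsets n) ++ map (outside ∷_) (subsets n)

nCk>0 : k ≤ n → 0 ℕ.< n C k
nCk>0 z≤n                         = s≤s z≤n
nCk>0 {suc k} {suc n} (s≤s k≤n) =
  ≤-trans (nCk>0 k≤n)
    (≤-trans (m≤m+n (n C k) (n C suc k)) (≤-reflexive (nCk+nC[k+1]≡[n+1]C[k+1] n k)))

density : (A : Permutation′ k) (π : Permutation′ n) → .(k ≤ n) → ℚ
density {k} {n} A π k≤n =
  _/_ (+ length (filter (induces? A π) (subsets n))) (n C k) {{ℕ.>-nonZero (nCk>0 k≤n)}}

Avoids : (A : Permutation′ k) (π : Permutation′ n) → .(k ≤ n) → Set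
Avoids A π k≤n = density A π k≤n ≡ 0ℚ

-- Σᵢ |π(i) − ρ(i)|; numbering from 0 rather than 1 leaves the differences unchanged.
footrule : Permutation′ n → Permutation′ n → ℕ
footrule {n} π ρ = sum-syntax +-0-monoid n λ i → ∣ toℕ (π ⟨$⟩ʳ i) - toℕ (ρ ⟨$⟩ʳ i) ∣

fromℕ : ℕ → ℚ
fromℕ m = + m / 1

module Submission where

-- Why the theorem holds.  Only the order of the values may be changed, and only
-- by small displacements, so values are treated coarsely and positions exactly.
-- Divide the values into few coarse levels, the letters; then `π` becomes a word,
-- and a permutation in which most positions keep their letter is close to `π`
-- (`footrule-≤`).
--
-- Cut the positions into nodes, and discard from a node the letters that are rare
-- there.  When the partition is refined, the sets of remaining letters can only
-- shrink, and if many nodes have a majority of children that lose a letter, then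
-- the average number of remaining letters drops by a fixed amount.  So at some
-- bounded depth almost every node has many children in which all its letters are
-- still dense (`Refinement.stage-exists`), however large the number of children
-- is chosen in terms of the number of nodes.
--
-- For each node, letter and such child there are many points in the child on a
-- single fine level of that letter, and these fine levels can be taken distinct
-- (`Levels.popular-level`, `distinctRepresentatives`).  By Ramsey's theorem there
-- are `k + 4` children, with the same indices at all nodes, for which the order of
-- the fine levels of a cell (a node with a letter) and another cell at indices
-- `i < j` depends on the two cells only (`Levels.template`).
--
-- This dependence extends to arbitrarily many indices: assign to each position a
-- cell, and compare two positions `p < q` as the fine levels of their cells at
-- the indices 0 and 1.  Any statement about at most `k + 4` positions can be
-- checked on the fine levels at increasing indices, so this is a linear order
-- (`SampleOrder`), and the permutation `π̃` with this order of values is close to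
-- `π`.  A copy of `A` in `π̃` shows `A` among the fine levels at increasing indices.
-- These are `k` sets of points of `π`, one to the right of the other, each of size
-- at least a fixed fraction of `n`, and every transversal of them is a copy of `A`
-- in `π` (`count-copies`), which a small density excludes.
--
-- Everything is computed with natural numbers, the density threshold and the
-- error being given by their reciprocals (`Removal.modify`).  For small `n` the
-- threshold is below the density of a single copy.

open import Defs
import Algebra.Properties.Semiring.Sum
open import Data.Fin as Fin using (Fin; zero; suc; toℕ; fromℕ<; cast)
open import Data.Fin.Permutation using (Permutation′; _⟨$⟩ʳ_; permutation)
import Data.Fin.Properties as Fin
open import Data.Fin.Subset using (Subset; inside; outside; ∣_∣)
import Data.Integer as ℤ
import Data.Integer.Properties as ℤ
open import Data.List using (List; []; _∷_; length; filter; map; upTo; cartesianProduct)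
open import Data.List.Membership.DecPropositional using () renaming (_∈?_ to ∈-decidable)
open import Data.List.Membership.Propositional using (_∈_; _∉_)
open import Data.List.Membership.Propositional.Properties using
  (∈-filter⁺; ∈-filter⁻; ∈-upTo⁺; ∈-upTo⁻; ∈-cartesianProduct⁺; ∈-cartesianProduct⁻; ∈-map⁺)
open import Data.List.Properties using
  (length-filter; length-upTo; length-map; length-++; filter-++; filter-accept; filter-none)
open import Data.List.Relation.Binary.Sublist.Propositional as Sublist using
  (_⊆_; []; _∷_; _∷ʳ_; ⊆-trans; minimum)
open import Data.List.Relation.Binary.Sublist.Propositional.Properties using (All-resp-⊆; filter-⊆)
open import Data.List.Relation.Unary.All as All using (All; []; _∷_)
open import Data.List.Relation.Unary.All.Properties using (all-filter; applyUpTo⁺₁)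
open import Data.List.Relation.Unary.AllPairs using (AllPairs; []; _∷_)
import Data.List.Relation.Unary.AllPairs.Properties as AllPairs
open import Data.List.Relation.Unary.Any using (here; there)
open import Data.Nat
open import Data.Nat.Combinatorics using (_C_; nCk+nC[k+1]≡[n+1]C[k+1]; k>n⇒nCk≡0)
open import Data.Nat.Divisibility using (n∣m*n)
open import Data.Nat.DivMod hiding (result)
open import Data.Nat.Properties
open import Data.Nat.Tactic.RingSolver using (solve-∀)
open import Data.Product using (Σ-syntax; ∃-syntax; _×_; _,_; proj₁; proj₂)
open import Data.Product.Properties using (≡-dec)
open import Data.Rational as ℚ using (ℚ; mkℚ; 0ℚ; toℚᵘ)
import Data.Rational.Properties as ℚ
open import Data.Rational.Unnormalised as ℚᵘ using (mkℚᵘ)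
import Data.Rational.Unnormalised.Properties as ℚᵘ
open import Data.Sum using (_⊎_; inj₁; inj₂; [_,_]′)
open import Data.Unit using (⊤; tt)
open import Data.Vec using ([]; _∷_)
open import Function using (_∘_; Injective)
open import Function.Bundles using (_⇔_; mk⇔; Equivalence)
open import Relation.Binary.Definitions using (tri<; tri≈; tri>)
open import Relation.Binary.PropositionalEquality
open import Relation.Nullary using (Dec; yes; no; ¬_; ¬?; contradiction)
open import Relation.Nullary.Decidable using (_×-dec_; _⊎-dec_)

module Sum = Algebra.Properties.Semiring.Sum +-*-semiring

-- Sums over initial segments of the natural numbers

-- The sum of `f 0 , … , f (n - 1)`.  It is opaque so that summands can be
-- inferred by unification.
opaque
  ∑ : ℕ → (ℕ → ℕ) → ℕ
  ∑ n f = Sum.sum {n} (f ∘ toℕ)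

  ∑-zero : ∀ f → ∑ 0 f ≡ 0
  ∑-zero f = refl

  ∑-suc : ∀ n f → ∑ (suc n) f ≡ f 0 + ∑ n (f ∘ suc)
  ∑-suc n f = refl

opaque
  unfolding ∑

  ∑-mono : ∀ n {f g : ℕ → ℕ} → (∀ i → i < n → f i ≤ g i) → ∑ n f ≤ ∑ n g
  ∑-mono zero    f≤g = z≤n
  ∑-mono (suc n) f≤g = +-mono-≤ (f≤g 0 z<s) (∑-mono n λ i i<n → f≤g (suc i) (s<s i<n))

∑-cong : ∀ n {f g : ℕ → ℕ} → (∀ i → i < n → f i ≡ g i) → ∑ n f ≡ ∑ n g
∑-cong n f≡g = ≤-antisym (∑-mono n λ i i<n → ≤-reflexive (f≡g i i<n))
                         (∑-mono n λ i i<n → ≤-reflexive (sym (f≡g i i<n)))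

opaque
  unfolding ∑

  ∑-mono-< : ∀ n {f g : ℕ → ℕ} → (∀ i → i < n → f i ≤ g i) →
             ∀ j → j < n → f j < g j → ∑ n f < ∑ n g
  ∑-mono-< (suc n) f≤g zero    _         fj<gj =
    +-mono-<-≤ fj<gj (∑-mono n λ i i<n → f≤g (suc i) (s<s i<n))
  ∑-mono-< (suc n) f≤g (suc j) (s<s j<n) fj<gj =
    +-mono-≤-< (f≤g 0 z<s) (∑-mono-< n (λ i i<n → f≤g (suc i) (s<s i<n)) j j<n fj<gj)

  ∑-+ : ∀ n (f g : ℕ → ℕ) → ∑ n (λ i → f i + g i) ≡ ∑ n f + ∑ n g
  ∑-+ n f g = Sum.∑-distrib-+ {n} (f ∘ toℕ) (g ∘ toℕ)

  *-∑ : ∀ c n (f : ℕ → ℕ) → c * ∑ n f ≡ ∑ n (λ i → c * f i)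
  *-∑ c n f = Sum.*-distribˡ-sum {n} c (f ∘ toℕ)

  ∑-swap : ∀ m n (f : ℕ → ℕ → ℕ) → ∑ m (λ i → ∑ n (f i)) ≡ ∑ n (λ j → ∑ m (λ i → f i j))
  ∑-swap m n f = Sum.∑-comm {m} {n} (λ i j → f (toℕ i) (toℕ j))

  ∑-const : ∀ n c → ∑ n (λ _ → c) ≡ n * c
  ∑-const zero    c = refl
  ∑-const (suc n) c = cong (c +_) (∑-const n c)

∑-≤-const : ∀ n {f : ℕ → ℕ} {c} → (∀ i → i < n → f i ≤ c) → ∑ n f ≤ n * c
∑-≤-const n {c = c} f≤c = ≤-trans (∑-mono n f≤c) (≤-reflexive (∑-const n c))

opaque
  unfolding ∑

  ∑-split : ∀ m n (f : ℕ → ℕ) → ∑ (m + n) f ≡ ∑ m f + ∑ n (λ i → f (m + i))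
  ∑-split zero    n f = refl
  ∑-split (suc m) n f = trans (cong (f 0 +_) (∑-split m n (f ∘ suc))) (sym (+-assoc (f 0) _ _))

-- Summation over `m` consecutive blocks of length `l`.
∑-blocks : ∀ m l (f : ℕ → ℕ) → ∑ (m * l) f ≡ ∑ m (λ J → ∑ l (λ i → f (J * l + i)))
∑-blocks zero    l f = trans (∑-zero f) (sym (∑-zero _))
∑-blocks (suc m) l f = trans (∑-split l (m * l) f) (trans (cong (∑ l f +_)
  (trans (∑-blocks m l (λ i → f (l + i)))
         (∑-cong m λ J _ → ∑-cong l λ i _ → cong f (sym (+-assoc l (J * l) i))))) (sym (∑-suc m _)))

∑-window : ∀ {n} lo l (f : ℕ → ℕ) → lo + l ≤ n → ∑ l (λ i → f (lo + i)) ≤ ∑ n f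
∑-window {n} lo l f lo+l≤n with m≤n⇒∃[o]m+o≡n lo+l≤n
... | o , refl = begin
  ∑ l (λ i → f (lo + i))          ≤⟨ m≤n+m _ _ ⟩
  ∑ lo f + ∑ l (λ i → f (lo + i)) ≡⟨ ∑-split lo l f ⟨
  ∑ (lo + l) f                    ≤⟨ m≤m+n _ _ ⟩
  ∑ (lo + l) f + _                ≡⟨ ∑-split (lo + l) o f ⟨
  ∑ (lo + l + o) f                ∎
  where open ≤-Reasoning

∑-monoˡ : ∀ {m n} (f : ℕ → ℕ) → m ≤ n → ∑ m f ≤ ∑ n f
∑-monoˡ {m} f = ∑-window 0 m f

opaque
  unfolding ∑

  ∑-term : ∀ {n} (f : ℕ → ℕ) j → j < n → f j ≤ ∑ n f
  ∑-term {suc n} f zero    _         = m≤m+n _ _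
  ∑-term {suc n} f (suc j) (s<s j<n) = ≤-trans (∑-term (f ∘ suc) j j<n) (m≤n+m _ _)

-- The indicator of a decided proposition; a sum of indicators counts the
-- indices at which a decidable predicate holds.
𝟙 : {P : Set} → Dec P → ℕ
𝟙 (yes _) = 1
𝟙 (no _)  = 0

𝟙-yes : {P : Set} (d : Dec P) → P → 𝟙 d ≡ 1
𝟙-yes (yes _) p = refl
𝟙-yes (no ¬p) p = contradiction p ¬p

𝟙-no : {P : Set} (d : Dec P) → ¬ P → 𝟙 d ≡ 0
𝟙-no (yes p) ¬p = contradiction p ¬p
𝟙-no (no _)  ¬p = refl

𝟙≤1 : {P : Set} (d : Dec P) → 𝟙 d ≤ 1
𝟙≤1 (yes _) = s≤s z≤n
𝟙≤1 (no _)  = z≤n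

𝟙-mono : {P Q : Set} (d : Dec P) (d′ : Dec Q) → (P → Q) → 𝟙 d ≤ 𝟙 d′
𝟙-mono (no _)  d′ f = z≤n
𝟙-mono (yes p) d′ f = ≤-reflexive (sym (𝟙-yes d′ (f p)))

𝟙-cover : {P Q R : Set} (d : Dec P) (d₁ : Dec Q) (d₂ : Dec R) → (P → Q ⊎ R) → 𝟙 d ≤ 𝟙 d₁ + 𝟙 d₂
𝟙-cover (no _)  d₁ d₂ f = z≤n
𝟙-cover (yes p) d₁ d₂ f with f p
... | inj₁ q = ≤-trans (≤-reflexive (sym (𝟙-yes d₁ q))) (m≤m+n _ _)
... | inj₂ r = ≤-trans (≤-reflexive (sym (𝟙-yes d₂ r))) (m≤n+m _ _)

opaque
  unfolding ∑

  ∑-witness : ∀ n {P : ℕ → Set} (P? : ∀ i → Dec (P i)) → 0 < ∑ n (λ i → 𝟙 (P? i)) →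
              ∃[ i ] (i < n × P i)
  ∑-witness (suc n) P? pos with P? 0
  ... | yes p = 0 , z<s , p
  ... | no _  with ∑-witness n (P? ∘ suc) pos
  ...   | i , i<n , p = suc i , s<s i<n , p

  ∑-𝟙≡-≤1 : ∀ n a → ∑ n (λ i → 𝟙 (i ≟ a)) ≤ 1
  ∑-𝟙≡-≤1 zero    a       = z≤n
  ∑-𝟙≡-≤1 (suc n) zero    = s≤s (≤-trans
    (∑-mono n λ i _ → ≤-reflexive (𝟙-no (suc i ≟ 0) λ ())) (≤-reflexive (trans (∑-const n 0) (*-zeroʳ n))))
  ∑-𝟙≡-≤1 (suc n) (suc a) = ≤-trans
    (∑-mono n λ i _ → 𝟙-mono (suc i ≟ suc a) (i ≟ a) suc-injective) (∑-𝟙≡-≤1 n a)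

∑-exists : ∀ n {P : ℕ → Set} (P? : ∀ i → Dec (P i)) → ∑ n (λ i → 𝟙 (¬? (P? i))) < n → ∃[ i ] P i
∑-exists n P? few with anyUpTo? P? n
... | yes (i , _ , p) = i , p
... | no none = contradiction few (≤⇒≯ (≤-reflexive (sym (trans
    (∑-cong n λ i i<n → 𝟙-yes (¬? (P? i)) λ p → none (i , i<n , p)) (trans (∑-const n 1) (*-identityʳ n))))))

∑-𝟙< : ∀ {n a} → a ≤ n → ∑ n (λ v → 𝟙 (v <? a)) ≡ a
∑-𝟙< {n} {a} a≤n with m≤n⇒∃[o]m+o≡n a≤n
... | o , refl = begin
  ∑ (a + o) (λ v → 𝟙 (v <? a))                               ≡⟨ ∑-split a o _ ⟩
  ∑ a (λ v → 𝟙 (v <? a)) + ∑ o (λ v → 𝟙 (a + v <? a))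
    ≡⟨ cong₂ _+_ (∑-cong a λ v v<a → 𝟙-yes (v <? a) v<a)
                 (∑-cong o λ v _ → 𝟙-no (a + v <? a) (m+n≮m a v)) ⟩
  ∑ a (λ _ → 1) + ∑ o (λ _ → 0)                              ≡⟨ cong₂ _+_ (∑-const a 1) (∑-const o 0) ⟩
  a * 1 + o * 0                                              ≡⟨ cong₂ _+_ (*-identityʳ a) (*-zeroʳ o) ⟩
  a + 0                                                      ≡⟨ +-identityʳ a ⟩
  a                                                          ∎
  where open ≡-Reasoning

[J*l+i]/l≡J : ∀ J {l i} .{{_ : NonZero l}} → i < l → (J * l + i) / l ≡ J
[J*l+i]/l≡J J {l} {i} i<l = begin
  (J * l + i) / l   ≡⟨ /-congˡ (+-comm (J * l) i) ⟩
  (i + J * l) / l   ≡⟨ +-distrib-/-∣ʳ i (n∣m*n J) ⟩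
  i / l + J * l / l ≡⟨ cong₂ _+_ (m<n⇒m/n≡0 i<l) (m*n/n≡m J l) ⟩
  J                 ∎
  where open ≡-Reasoning

∑-𝟙/-≤ : ∀ n w .{{_ : NonZero w}} a → ∑ n (λ v → 𝟙 (v / w ≟ a)) ≤ w
∑-𝟙/-≤ n w a = begin
  ∑ n (λ v → 𝟙 (v / w ≟ a))                             ≤⟨ ∑-monoˡ _ (m≤m*n n w) ⟩
  ∑ (n * w) (λ v → 𝟙 (v / w ≟ a))                       ≡⟨ ∑-blocks n w _ ⟩
  ∑ n (λ J → ∑ w (λ i → 𝟙 ((J * w + i) / w ≟ a)))
    ≤⟨ ∑-mono n (λ J _ → ∑-mono w λ i i<w → 𝟙-mono (_ ≟ a) (J ≟ a) (trans (sym ([J*l+i]/l≡J J i<w)))) ⟩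
  ∑ n (λ J → ∑ w (λ _ → 𝟙 (J ≟ a)))                     ≡⟨ ∑-cong n (λ J _ → ∑-const w _) ⟩
  ∑ n (λ J → w * 𝟙 (J ≟ a))                             ≡⟨ *-∑ w n _ ⟨
  w * ∑ n (λ J → 𝟙 (J ≟ a))                             ≤⟨ *-monoʳ-≤ w (∑-𝟙≡-≤1 n a) ⟩
  w * 1                                                 ≡⟨ *-identityʳ w ⟩
  w                                                     ∎
  where open ≤-Reasoning

opaque
  unfolding ∑

  -- The first `ρ` indices at which a predicate holds, in increasing order.
  select : ∀ n ρ {P : ℕ → Set} (P? : ∀ i → Dec (P i)) → ρ ≤ ∑ n (λ i → 𝟙 (P? i)) →
           Σ[ g ∈ (ℕ → ℕ) ] ((∀ s → s < ρ → g s < n × P (g s)) ×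
                             (∀ s t → s < t → t < ρ → g s < g t))
  select n       zero    P? _   = (λ s → s) , (λ _ ()) , λ _ _ _ ()
  select (suc n) (suc ρ) P? ρ≤∑ with P? 0
  select (suc n) (suc ρ) {P} P? ρ≤∑ | yes p with select n ρ (P? ∘ suc) (s≤s⁻¹ ρ≤∑)
  ... | g , prop , mono = g′ , prop′ , mono′
    where
    g′ : ℕ → ℕ
    g′ zero    = 0
    g′ (suc s) = suc (g s)
    prop′ : ∀ s → s < suc ρ → g′ s < suc n × P (g′ s)
    prop′ zero    _         = z<s , p
    prop′ (suc s) (s<s s<ρ) = s<s (proj₁ (prop s s<ρ)) , proj₂ (prop s s<ρ)
    mono′ : ∀ s t → s < t → t < suc ρ → g′ s < g′ t
    mono′ zero    (suc t) _         _         = z<s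
    mono′ (suc s) (suc t) (s<s s<t) (s<s t<ρ) = s<s (mono s t s<t t<ρ)
  select (suc n) (suc ρ) P? ρ≤∑ | no _ with select n (suc ρ) (P? ∘ suc) ρ≤∑
  ... | g , prop , mono = suc ∘ g
                        , (λ s s<ρ → s<s (proj₁ (prop s s<ρ)) , proj₂ (prop s s<ρ))
                        , λ s t s<t t<ρ → s<s (mono s t s<t t<ρ)

-- Ramsey's theorem for pairs in a list

AllPairs-resp-⊆ : ∀ {A : Set} {R : A → A → Set} {xs ys : List A} →
                  xs ⊆ ys → AllPairs R ys → AllPairs R xs
AllPairs-resp-⊆ []         []       = []
AllPairs-resp-⊆ (_ ∷ʳ s)   (_ ∷ ps) = AllPairs-resp-⊆ s ps
AllPairs-resp-⊆ (refl ∷ s) (p ∷ ps) = All-resp-⊆ s p ∷ AllPairs-resp-⊆ s ps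

length-filter+filter-¬ : ∀ {A : Set} {P : A → Set} (P? : ∀ x → Dec (P x)) xs →
  length (filter P? xs) + length (filter (¬? ∘ P?) xs) ≡ length xs
length-filter+filter-¬ P? [] = refl
length-filter+filter-¬ P? (x ∷ xs) with P? x
... | yes _ = cong suc (length-filter+filter-¬ P? xs)
... | no _  = trans (+-suc _ _) (cong suc (length-filter+filter-¬ P? xs))

-- The usual induction: the head of the list is related, or unrelated, to at
-- least half of the tail.
ramsey₂ : ∀ {A : Set} {R : A → A → Set} (R? : ∀ x y → Dec (R x y)) a b xs → 2 ^ (a + b) ≤ length xs →
          (∃[ ys ] (ys ⊆ xs × length ys ≡ a × AllPairs R ys)) ⊎
          (∃[ ys ] (ys ⊆ xs × length ys ≡ b × AllPairs (λ x y → ¬ R x y) ys))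
ramsey₂ R? zero    b       xs       _ = inj₁ ([] , minimum xs , refl , [])
ramsey₂ R? (suc a) zero    xs       _ = inj₂ ([] , minimum xs , refl , [])
ramsey₂ R? (suc a) (suc b) []       h = contradiction h (<⇒≱ (>-nonZero⁻¹ (2 ^ (suc a + suc b)) ⦃ m^n≢0 2 (suc a + suc b) ⦄))
ramsey₂ {R = R} R? (suc a) (suc b) (x ∷ xs) h = go (2 ^ (a + suc b) ≤? length fs)
  where
  fs gs : List _
  fs = filter (R? x) xs
  gs = filter (¬? ∘ R? x) xs
  Goal : Set _
  Goal = (∃[ ys ] (ys ⊆ x ∷ xs × length ys ≡ suc a × AllPairs R ys)) ⊎
         (∃[ ys ] (ys ⊆ x ∷ xs × length ys ≡ suc b × AllPairs (λ y z → ¬ R y z) ys))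
  large : ¬ (2 ^ (a + suc b) ≤ length fs) → 2 ^ (suc a + b) ≤ length gs
  large ≰fs = +-cancelˡ-≤ (length fs) _ _ (s≤s⁻¹ (begin
    suc (length fs + 2 ^ (suc a + b))     ≡⟨ cong (λ z → suc (length fs + 2 ^ z)) (+-suc a b) ⟨
    suc (length fs) + 2 ^ (a + suc b)     ≤⟨ +-monoˡ-≤ _ (≰⇒> ≰fs) ⟩
    2 ^ (a + suc b) + 2 ^ (a + suc b)     ≡⟨ cong (2 ^ (a + suc b) +_) (+-identityʳ _) ⟨
    2 ^ (suc a + suc b)                   ≤⟨ h ⟩
    suc (length xs)                       ≡⟨ cong suc (length-filter+filter-¬ (R? x) xs) ⟨
    suc (length fs + length gs)           ∎))
    where open ≤-Reasoning
  go : Dec (2 ^ (a + suc b) ≤ length fs) → Goal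
  go (yes ≤fs) with ramsey₂ R? a (suc b) fs ≤fs
  ... | inj₁ (ys , s , len , ps) =
    inj₁ (x ∷ ys , refl ∷ ⊆-trans s (filter-⊆ (R? x) xs) , cong suc len
         , All-resp-⊆ s (all-filter (R? x) xs) ∷ ps)
  ... | inj₂ (ys , s , len , ps) =
    inj₂ (ys , x ∷ʳ ⊆-trans s (filter-⊆ (R? x) xs) , len , ps)
  go (no ≰fs) with ramsey₂ R? (suc a) b gs (large ≰fs)
  ... | inj₁ (ys , s , len , ps) =
    inj₁ (ys , x ∷ʳ ⊆-trans s (filter-⊆ (¬? ∘ R? x) xs) , len , ps)
  ... | inj₂ (ys , s , len , ps) =
    inj₂ (x ∷ ys , refl ∷ ⊆-trans s (filter-⊆ (¬? ∘ R? x) xs) , cong suc len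
         , All-resp-⊆ s (all-filter (¬? ∘ R? x) xs) ∷ ps)

-- A size that makes `c` relations simultaneously homogeneous on `κ` elements.
ramseyNumber : ℕ → ℕ → ℕ
ramseyNumber zero    κ = κ
ramseyNumber (suc c) κ = 2 ^ (ramseyNumber c κ + ramseyNumber c κ)

-- The relation holds for all pairs of the list, in list order, or for none.
Homogeneous : {A : Set} → (A → A → Set) → List A → Set
Homogeneous R ys = AllPairs R ys ⊎ AllPairs (λ x y → ¬ R x y) ys

-- The relations are made homogeneous one after the other.
ramsey : ∀ {A J : Set} {R : J → A → A → Set} (R? : ∀ j x y → Dec (R j x y)) κ js xs →
         ramseyNumber (length js) κ ≤ length xs →
         ∃[ ys ] (ys ⊆ xs × κ ≤ length ys × All (λ j → Homogeneous (R j) ys) js)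
ramsey R? κ []       xs h = xs , Sublist.⊆-refl , h , []
ramsey R? κ (j ∷ js) xs h with ramsey₂ (R? j) (ramseyNumber (length js) κ) _ xs h
... | inj₁ (ys , s , len , ps) with ramsey R? κ js ys (≤-reflexive (sym len))
...   | zs , s′ , len′ , hs = zs , ⊆-trans s′ s , len′ , inj₁ (AllPairs-resp-⊆ s′ ps) ∷ hs
ramsey R? κ (j ∷ js) xs h | inj₂ (ys , s , len , ps) with ramsey R? κ js ys (≤-reflexive (sym len))
...   | zs , s′ , len′ , hs = zs , ⊆-trans s′ s , len′ , inj₂ (AllPairs-resp-⊆ s′ ps) ∷ hs

-- The entry of a list at a position, with the junk value 0 past the end.
at : List ℕ → ℕ → ℕ
at []       _       = 0
at (x ∷ xs) zero    = x
at (x ∷ xs) (suc i) = at xs i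

All-at : ∀ {P : ℕ → Set} {xs} → All P xs → ∀ i → i < length xs → P (at xs i)
All-at (p ∷ ps) zero    _         = p
All-at (p ∷ ps) (suc i) (s<s i<n) = All-at ps i i<n

AllPairs-at : ∀ {R : ℕ → ℕ → Set} {xs} → AllPairs R xs →
              ∀ i j → i < j → j < length xs → R (at xs i) (at xs j)
AllPairs-at (p ∷ ps) zero    (suc j) _         (s<s j<n) = All-at p j j<n
AllPairs-at (p ∷ ps) (suc i) (suc j) (s<s i<j) (s<s j<n) = AllPairs-at ps i j i<j j<n

-- The form used for samples: the homogeneous set is given by its increasing
-- enumeration `r 0 < … < r (κ - 1)`.
ramseyℕ : ∀ {J : Set} {R : J → ℕ → ℕ → Set} (R? : ∀ j x y → Dec (R j x y)) κ (js : List J) →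
  Σ[ r ∈ (ℕ → ℕ) ] (
    (∀ i → i < κ → r i < ramseyNumber (length js) κ) ×
    (∀ i j → i < j → j < κ → r i < r j) ×
    All (λ c → ∀ i j i′ j′ → i < j → j < κ → i′ < j′ → j′ < κ →
               R c (r i) (r j) → R c (r i′) (r j′)) js)
ramseyℕ {R = R} R? κ js with ramsey R? κ js (upTo ρ) (≤-reflexive (sym (length-upTo ρ)))
  where ρ = ramseyNumber (length js) κ
... | ys , s , κ≤len , hs =
  at ys
  , (λ i i<κ → All-at (All-resp-⊆ s (applyUpTo⁺₁ _ _ λ i<n → i<n)) i (<-≤-trans i<κ κ≤len))
  , (λ i j i<j j<κ → AllPairs-at (AllPairs-resp-⊆ s (AllPairs.applyUpTo⁺₁ _ _ λ i<j _ → i<j)) i j i<j (<-≤-trans j<κ κ≤len))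
  , All.map hom hs
  where
  hom : ∀ {c} → Homogeneous (R c) ys → ∀ i j i′ j′ → i < j → j < κ → i′ < j′ → j′ < κ →
        R c (at ys i) (at ys j) → R c (at ys i′) (at ys j′)
  hom (inj₁ ps) i j i′ j′ i<j j<κ i′<j′ j′<κ r = AllPairs-at ps i′ j′ i′<j′ (<-≤-trans j′<κ κ≤len)
  hom (inj₂ ps) i j i′ j′ i<j j<κ i′<j′ j′<κ r =
    contradiction r (AllPairs-at ps i j i<j (<-≤-trans j<κ κ≤len))

-- Refining a partition of the positions until most nodes are stable

¬×⇒¬⊎¬ : ∀ {P Q : Set} → Dec P → ¬ (P × Q) → ¬ P ⊎ ¬ Q
¬×⇒¬⊎¬ (yes p) ¬pq = inj₂ λ q → ¬pq (p , q)
¬×⇒¬⊎¬ (no ¬p) ¬pq = inj₁ ¬p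

-- The number of leaves of depth `d` below a node, in a tree where each node of a
-- level with `M` nodes has `2 * ram M` children.  The branching depends on the
-- number of nodes, because it has to exceed a Ramsey number for relations indexed
-- by pairs of nodes.
leaves : (ℕ → ℕ) → ℕ → ℕ → ℕ
leaves ram M zero    = 1
leaves ram M (suc d) = 2 * ram M * leaves ram (M * (2 * ram M)) d

leaves≢0 : ∀ {ram : ℕ → ℕ} → (∀ M → NonZero (ram M)) → ∀ M d → NonZero (leaves ram M d)
leaves≢0       ram≢0 M zero    = _
leaves≢0 {ram} ram≢0 M (suc d) = m*n≢0 (2 * ram M) (leaves ram (M * (2 * ram M)) d)
  ⦃ m*n≢0 2 (ram M) ⦃ _ ⦄ ⦃ ram≢0 M ⦄ ⦄ ⦃ leaves≢0 ram≢0 (M * (2 * ram M)) d ⦄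

-- Position `p` carries the letter `lt p`, one of `ℓ`.  Node `J` of a partition
-- into intervals of length `l` consists of the positions `J * l + i`, `i < l`.
module Refinement (lt : ℕ → ℕ) (ℓ : ℕ) (lt<ℓ : ∀ p → lt p < ℓ) (g : ℕ) where

  -- The number of occurrences of the letter `a` in node `J`.
  frequency : ℕ → ℕ → ℕ → ℕ
  frequency l J a = ∑ l (λ i → 𝟙 (lt (J * l + i) ≟ a))

  -- The letter `a` makes up at least one part in `g` of node `J`.
  Dense : ℕ → ℕ → ℕ → Set
  Dense l J a = l ≤ g * frequency l J a

  -- The decision procedures are abstract, so that no count is unfolded into them.
  abstract
    Dense? : ∀ l J a → Dec (Dense l J a)
    Dense? l J a = l ≤? g * frequency l J a

  -- Per node, the positions whose letter is not dense there are at most `ℓ`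
  -- parts in `g`.
  few-sparse : ∀ l J → g * ∑ l (λ i → 𝟙 (¬? (Dense? l J (lt (J * l + i))))) ≤ ℓ * l
  few-sparse l J = begin
    g * ∑ l (λ i → 𝟙 (¬? (Dense? l J (lt (J * l + i)))))
      ≤⟨ *-monoʳ-≤ g (∑-mono l λ i _ → spread i) ⟩
    g * ∑ l (λ i → ∑ ℓ (λ a → 𝟙 (¬? (Dense? l J a) ×-dec (lt (J * l + i) ≟ a))))
      ≡⟨ cong (g *_) (∑-swap l ℓ _) ⟩
    g * ∑ ℓ (λ a → ∑ l (λ i → 𝟙 (¬? (Dense? l J a) ×-dec (lt (J * l + i) ≟ a))))
      ≡⟨ *-∑ g ℓ _ ⟩
    ∑ ℓ (λ a → g * ∑ l (λ i → 𝟙 (¬? (Dense? l J a) ×-dec (lt (J * l + i) ≟ a))))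
      ≤⟨ ∑-≤-const ℓ (λ a _ → letter a) ⟩
    ℓ * l ∎
    where
    open ≤-Reasoning
    spread : ∀ i → 𝟙 (¬? (Dense? l J (lt (J * l + i)))) ≤
                   ∑ ℓ (λ a → 𝟙 (¬? (Dense? l J a) ×-dec (lt (J * l + i) ≟ a)))
    spread i = ≤-trans (𝟙-mono _ (¬? (Dense? l J (lt (J * l + i))) ×-dec (lt (J * l + i) ≟ lt (J * l + i))) (_, refl))
                       (∑-term _ (lt (J * l + i)) (lt<ℓ _))
    letter : ∀ a → g * ∑ l (λ i → 𝟙 (¬? (Dense? l J a) ×-dec (lt (J * l + i) ≟ a))) ≤ l
    letter a with Dense? l J a
    ... | yes d = ≤-trans (≤-reflexive (trans (cong (g *_)
                    (trans (∑-cong l λ i _ → 𝟙-no (¬? (yes d) ×-dec (lt (J * l + i) ≟ a)) λ (¬d , _) → ¬d d) (trans (∑-const l 0) (*-zeroʳ l)))) (*-zeroʳ g))) z≤n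
    ... | no ¬d = ≤-trans (*-monoʳ-≤ g (∑-mono l λ i _ → 𝟙-mono _ (lt (J * l + i) ≟ a) proj₂)) (<⇒≤ (≰⇒> ¬d))

  -- Each node `J` has a support, the letters `a` with `supp J a`.
  module _ {supp : ℕ → ℕ → Set} (supp? : ∀ J a → Dec (supp J a)) where

    -- The number of letters in the support of a node.
    size : ℕ → ℕ
    size J = ∑ ℓ (λ a → 𝟙 (supp? J a))

    -- The number of positions, in `M` nodes of length `l`, whose letter is not in
    -- the support of their node.
    lost : ℕ → ℕ → ℕ
    lost M l = ∑ M (λ J → ∑ l (λ i → 𝟙 (¬? (supp? J (lt (J * l + i))))))

  -- One refinement: each of `M` nodes is cut into `2 * ρ` children of length `l`.
  module Step {supp : ℕ → ℕ → Set} (supp? : ∀ J a → Dec (supp J a))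
              (M ρ l : ℕ) .⦃ _ : NonZero (2 * ρ) ⦄ where

    r : ℕ
    r = 2 * ρ

    -- The support of a child: the letters of the support of its parent that are
    -- dense in the child.  Supports thus decrease along the tree.
    refined : ℕ → ℕ → Set
    refined J a = supp (J / r) a × Dense l J a

    abstract
      refined? : ∀ J a → Dec (refined J a)
      refined? J a = supp? (J / r) a ×-dec Dense? l J a

    lost-refined : g * lost refined? (M * r) l ≤ g * lost supp? M (r * l) + ℓ * (M * r * l)
    lost-refined = begin
      g * lost refined? (M * r) l
        ≤⟨ *-monoʳ-≤ g (∑-mono (M * r) λ J _ → ≤-trans (∑-mono l λ i _ → cover J i) (≤-reflexive (∑-+ l _ _))) ⟩
      g * ∑ (M * r) (λ J → coarser J + sparser J)
        ≡⟨ trans (cong (g *_) (∑-+ (M * r) coarser sparser)) (*-distribˡ-+ g _ _) ⟩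
      g * ∑ (M * r) coarser + g * ∑ (M * r) sparser
        ≤⟨ +-mono-≤ (≤-reflexive (cong (g *_) coarser≡)) sparser≤ ⟩
      g * lost supp? M (r * l) + ℓ * (M * r * l) ∎
      where
      open ≤-Reasoning
      coarser sparser : ℕ → ℕ
      coarser J = ∑ l (λ i → 𝟙 (¬? (supp? (J / r) (lt (J * l + i)))))
      sparser J = ∑ l (λ i → 𝟙 (¬? (Dense? l J (lt (J * l + i)))))
      cover : ∀ J i → 𝟙 (¬? (refined? J (lt (J * l + i)))) ≤
              𝟙 (¬? (supp? (J / r) (lt (J * l + i)))) + 𝟙 (¬? (Dense? l J (lt (J * l + i))))
      cover J i = 𝟙-cover (¬? (refined? J a)) (¬? (supp? (J / r) a)) (¬? (Dense? l J a))
                      (¬×⇒¬⊎¬ (supp? (J / r) a))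
        where a = lt (J * l + i)
      regroup : ∀ v r c l i → (v * r + c) * l + i ≡ v * (r * l) + (c * l + i)
      regroup = solve-∀
      coarser≡ : ∑ (M * r) coarser ≡ lost supp? M (r * l)
      coarser≡ = trans (∑-blocks M r coarser) (∑-cong M λ v _ → trans
        (∑-cong r λ c c<r → ∑-cong l λ i _ → cong₂ (λ J p → 𝟙 (¬? (supp? J (lt p)))) ([J*l+i]/l≡J v c<r) (regroup v r c l i))
        (sym (∑-blocks r l λ i → 𝟙 (¬? (supp? v (lt (v * (r * l) + i)))))))
      sparser≤ : g * ∑ (M * r) sparser ≤ ℓ * (M * r * l)
      sparser≤ = begin
        g * ∑ (M * r) sparser             ≡⟨ *-∑ g (M * r) sparser ⟩
        ∑ (M * r) (λ J → g * sparser J)   ≤⟨ ∑-≤-const (M * r) (λ J _ → few-sparse l J) ⟩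
        M * r * (ℓ * l)                   ≡⟨ swap (M * r) ℓ l ⟩
        ℓ * (M * r * l)                   ∎
        where swap : ∀ x y z → x * (y * z) ≡ y * (x * z)
              swap = solve-∀

    refined-≤ : ∀ v c → c < r → ∀ a → 𝟙 (refined? (v * r + c) a) ≤ 𝟙 (supp? v a)
    refined-≤ v c c<r a = 𝟙-mono _ (supp? v a)
      λ (s , _) → subst (λ J → supp J a) ([J*l+i]/l≡J v c<r) s

    size-refined-≤ : ∀ v c → c < r → size refined? (v * r + c) ≤ size supp? v
    size-refined-≤ v c c<r = ∑-mono ℓ λ a _ → refined-≤ v c c<r a

    -- Child `c` of node `v` has the support of `v`.  Since it is a subset, comparing
    -- sizes is enough.
    Same : ℕ → ℕ → Set
    Same v c = size supp? v ≤ size refined? (v * r + c)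

    abstract
      Same? : ∀ v c → Dec (Same v c)
      Same? v c = size supp? v ≤? size refined? (v * r + c)

    Same-refined : ∀ v c → c < r → Same v c → ∀ a → a < ℓ → supp v a → refined (v * r + c) a
    Same-refined v c c<r same a a<ℓ s with refined? (v * r + c) a in eq
    ... | yes p = p
    ... | no ¬p = contradiction same (<⇒≱ (∑-mono-< ℓ (λ a _ → refined-≤ v c c<r a) a a<ℓ
            (≤-reflexive (trans (cong (suc ∘ 𝟙) eq) (sym (𝟙-yes (supp? v a) s))))))

    -- At least half of the children of a node keep its support.
    Stable : ℕ → Set
    Stable v = ρ ≤ ∑ r (λ c → 𝟙 (Same? v c))

    abstract
      Stable? : ∀ v → Dec (Stable v)
      Stable? v = ρ ≤? ∑ r (λ c → 𝟙 (Same? v c))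

    -- An unstable node has more than `ρ` children that lose at least one letter.
    drop : ∀ v → ∑ r (λ c → size refined? (v * r + c)) + ρ * 𝟙 (¬? (Stable? v)) ≤ r * size supp? v
    drop v with Stable? v
    ... | yes _ = ≤-trans (≤-reflexive (trans (cong (S +_) (*-zeroʳ ρ)) (+-identityʳ S)))
                          (∑-≤-const r λ c c<r → size-refined-≤ v c c<r)
      where S = ∑ r (λ c → size refined? (v * r + c))
    ... | no ¬stable = +-cancelʳ-≤ ρ _ _ (begin
      S + ρ * 1 + ρ                                      ≡⟨ twice S ρ ⟩
      S + r * 1                                          ≡⟨ cong (S +_) (∑-const r 1) ⟨
      S + ∑ r (λ _ → 1)                                  ≡⟨ ∑-+ r _ _ ⟨
      ∑ r (λ c → size refined? (v * r + c) + 1)          ≤⟨ ∑-mono r (λ c c<r → step c c<r) ⟩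
      ∑ r (λ c → size supp? v + 𝟙 (Same? v c))           ≡⟨ ∑-+ r _ _ ⟩
      ∑ r (λ _ → size supp? v) + ∑ r (λ c → 𝟙 (Same? v c))
        ≤⟨ +-mono-≤ (≤-reflexive (∑-const r _)) (<⇒≤ (≰⇒> ¬stable)) ⟩
      r * size supp? v + ρ                               ∎)
      where
      open ≤-Reasoning
      S = ∑ r (λ c → size refined? (v * r + c))
      twice : ∀ S ρ → S + ρ * 1 + ρ ≡ S + 2 * ρ * 1
      twice = solve-∀
      step : ∀ c → c < r → size refined? (v * r + c) + 1 ≤ size supp? v + 𝟙 (Same? v c)
      step c c<r with Same? v c
      ... | yes _    = +-monoˡ-≤ 1 (size-refined-≤ v c c<r)
      ... | no ¬same = ≤-trans (≤-reflexive (+-comm _ 1)) (≤-trans (≰⇒> ¬same) (m≤m+n _ 0))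

    -- The number of unstable nodes.
    unstable : ℕ
    unstable = ∑ M (λ v → 𝟙 (¬? (Stable? v)))

    -- The potential, the sum of the support sizes weighted by the length of the
    -- nodes, drops by half of the total length of the unstable nodes.
    potential-drop : 2 * (l * ∑ (M * r) (size refined?)) + r * l * unstable ≤
                     2 * (r * l * ∑ M (size supp?))
    potential-drop = begin
      2 * (l * ∑ (M * r) (size refined?)) + r * l * unstable
        ≡⟨ collect l (∑ (M * r) (size refined?)) ρ unstable ⟩
      2 * l * (∑ (M * r) (size refined?) + ρ * unstable)
        ≡⟨ cong (2 * l *_) (cong₂ _+_ (∑-blocks M r (size refined?)) (*-∑ ρ M _)) ⟩
      2 * l * (∑ M (λ v → ∑ r (λ c → size refined? (v * r + c))) + ∑ M (λ v → ρ * 𝟙 (¬? (Stable? v))))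
        ≡⟨ cong (2 * l *_) (∑-+ M _ _) ⟨
      2 * l * ∑ M (λ v → ∑ r (λ c → size refined? (v * r + c)) + ρ * 𝟙 (¬? (Stable? v)))
        ≤⟨ *-monoʳ-≤ (2 * l) (∑-mono M λ v _ → drop v) ⟩
      2 * l * ∑ M (λ v → r * size supp? v)
        ≡⟨ cong (2 * l *_) (*-∑ r M _) ⟨
      2 * l * (r * ∑ M (size supp?))
        ≡⟨ shuffle l r _ ⟩
      2 * (r * l * ∑ M (size supp?)) ∎
      where
      open ≤-Reasoning
      collect : ∀ l S ρ u → 2 * (l * S) + 2 * ρ * l * u ≡ 2 * l * (S + ρ * u)
      collect = solve-∀
      shuffle : ∀ l r S → 2 * l * (r * S) ≡ 2 * (r * l * S)
      shuffle = solve-∀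

  -- A partition of the positions below `W` into `M` nodes, each cut into
  -- `2 * ram M` children of length `l`, of which the children `child v s` with
  -- `s < ram M` are selected.  A letter that is active at a node is dense in all
  -- its selected children; at most two parts in `c` of the positions carry a
  -- letter that is not active at their node.
  record Stage (ram : ℕ → ℕ) (b c W : ℕ) : Set₁ where
    field
      M l : ℕ
    ρ = ram M
    r = 2 * ρ
    field
      covers      : M * (r * l) ≡ W
      b≤l         : b ≤ l
      Active      : ℕ → ℕ → Set
      Active?     : ∀ v a → Dec (Active v a)
      child       : ℕ → ℕ → ℕ
      child<r     : ∀ v a s → Active v a → s < ρ → child v s < r
      child-mono  : ∀ v a s t → Active v a → s < t → t < ρ → child v s < child v t
      child-dense : ∀ v a s → Active v a → a < ℓ → s < ρ → Dense l (v * r + child v s) a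
      few-lost    : c * lost Active? M (r * l) ≤ 2 * W

  module _ (ram : ℕ → ℕ) (ram≢0 : ∀ M → NonZero (ram M)) (b c W T : ℕ)
           .⦃ _ : NonZero (T * ℓ) ⦄ (g≡ : g ≡ c * (T * ℓ)) where

    -- The active letters of a stable node are its support; an unstable node has
    -- none.
    stage-here : ∀ {supp : ℕ → ℕ → Set} (supp? : ∀ J a → Dec (supp J a)) M l .⦃ _ : NonZero (2 * ram M) ⦄ →
                 M * (2 * ram M * l) ≡ W → b ≤ l →
                 g * lost supp? M (2 * ram M * l) ≤ T * (ℓ * W) →
                 c * (2 * ram M * l * Step.unstable supp? M (ram M) l) ≤ W →
                 Stage ram b c W
    stage-here {supp} supp? M l covers b≤l lost≤ unstable≤ = record
      { M = M ; l = l ; covers = covers ; b≤l = b≤l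
      ; Active = λ v a → supp v a × Stable v
      ; Active? = λ v a → supp? v a ×-dec Stable? v
      ; child = λ v → child v (Stable? v)
      ; child<r = λ v a s (_ , st) s<ρ → proj₁ (proj₁ (child-spec v (Stable? v) st) s s<ρ)
      ; child-mono = λ v a s t (_ , st) → proj₂ (child-spec v (Stable? v) st) s t
      ; child-dense = λ v a s (su , st) a<ℓ s<ρ →
          let c<r , same = proj₁ (child-spec v (Stable? v) st) s s<ρ
          in  proj₂ (Same-refined v _ c<r same a a<ℓ su)
      ; few-lost = few-lost
      }
      where
      open Step supp? M (ram M) l
      child : ∀ v → Dec (Stable v) → ℕ → ℕ
      child v (yes st) = proj₁ (select r (ram M) (Same? v) st)
      child v (no _)   = λ s → s
      child-spec : ∀ v (d : Dec (Stable v)) → Stable v →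
        (∀ s → s < ram M → child v d s < r × Same v (child v d s)) ×
        (∀ s t → s < t → t < ram M → child v d s < child v d t)
      child-spec v (yes st) _  = proj₂ (select r (ram M) (Same? v) st)
      child-spec v (no ¬st) st = contradiction st ¬st
      c*lost≤W : c * lost supp? M (r * l) ≤ W
      c*lost≤W = *-cancelˡ-≤ (T * ℓ) (begin
        T * ℓ * (c * lost supp? M (r * l))   ≡⟨ rearr (T * ℓ) c _ ⟩
        c * (T * ℓ) * lost supp? M (r * l)   ≡⟨ cong (_* lost supp? M (r * l)) g≡ ⟨
        g * lost supp? M (r * l)             ≤⟨ lost≤ ⟩
        T * (ℓ * W)                          ≡⟨ *-assoc T ℓ W ⟨
        T * ℓ * W                            ∎)
        where open ≤-Reasoning
              rearr : ∀ x c y → x * (c * y) ≡ c * x * y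
              rearr = solve-∀
      few-lost : c * lost (λ v a → supp? v a ×-dec Stable? v) M (r * l) ≤ 2 * W
      few-lost = begin
        c * lost (λ v a → supp? v a ×-dec Stable? v) M (r * l)
          ≤⟨ *-monoʳ-≤ c (∑-mono M λ v _ → node v) ⟩
        c * ∑ M (λ v → lostAt v + r * l * 𝟙 (¬? (Stable? v)))
          ≡⟨ cong (c *_) (∑-+ M _ _) ⟩
        c * (lost supp? M (r * l) + ∑ M (λ v → r * l * 𝟙 (¬? (Stable? v))))
          ≡⟨ trans (*-distribˡ-+ c _ _) (cong (λ z → c * lost supp? M (r * l) + c * z) (sym (*-∑ (r * l) M _))) ⟩
        c * lost supp? M (r * l) + c * (r * l * unstable)
          ≤⟨ +-mono-≤ c*lost≤W unstable≤ ⟩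
        W + W
          ≡⟨ cong (W +_) (+-identityʳ W) ⟨
        2 * W ∎
        where
        open ≤-Reasoning
        lostAt : ℕ → ℕ
        lostAt v = ∑ (r * l) (λ i → 𝟙 (¬? (supp? v (lt (v * (r * l) + i)))))
        node : ∀ v → ∑ (r * l) (λ i → 𝟙 (¬? (supp? v (lt (v * (r * l) + i)) ×-dec Stable? v))) ≤
                     lostAt v + r * l * 𝟙 (¬? (Stable? v))
        node v = ≤-trans
          (∑-mono (r * l) λ i _ → 𝟙-cover (¬? (supp? v (lt (v * (r * l) + i)) ×-dec Stable? v)) (¬? (supp? v (lt (v * (r * l) + i)))) (¬? (Stable? v)) (¬×⇒¬⊎¬ (supp? v (lt (v * (r * l) + i)))))
          (≤-reflexive (trans (∑-+ (r * l) _ _) (cong (lostAt v +_) (∑-const (r * l) _))))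

    -- At depth `t`, with `d` levels of the tree left: either few positions are in
    -- unstable nodes, or the refinement lowers the potential by a fixed amount,
    -- which cannot happen `d` times.
    search : ∀ d t M l {supp : ℕ → ℕ → Set} (supp? : ∀ J a → Dec (supp J a)) →
             l ≡ leaves ram M d * b → M * l ≡ W → t + d ≡ T →
             g * lost supp? M l ≤ t * (ℓ * W) →
             c * (2 * (l * ∑ M (size supp?))) < d * W →
             Stage ram b c W
    search (suc d) t M _ supp? refl Ml≡W t+d≡T lost≤ potential< =
      go (c * (2 * ram M * l * unstable) ≤? W)
      where
      instance
        r≢0 : NonZero (2 * ram M)
        r≢0 = m*n≢0 2 (ram M) ⦃ _ ⦄ ⦃ ram≢0 M ⦄
      l : ℕ
      l = leaves ram (M * (2 * ram M)) d * b
      open Step supp? M (ram M) l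
      len≡ : leaves ram M (suc d) * b ≡ r * l
      len≡ = *-assoc r _ b
      covers : M * (r * l) ≡ W
      covers = trans (cong (M *_) (sym len≡)) Ml≡W
      lost≤′ : g * lost supp? M (r * l) ≤ t * (ℓ * W)
      lost≤′ = subst (λ z → g * lost supp? M z ≤ t * (ℓ * W)) len≡ lost≤
      Mrl≡W : M * r * l ≡ W
      Mrl≡W = trans (*-assoc M r l) covers
      go : Dec (c * (r * l * unstable) ≤ W) → Stage ram b c W
      go (yes few) = stage-here supp? M l covers
        (m≤n*m b (leaves ram (M * r) d) ⦃ leaves≢0 ram≢0 (M * r) d ⦄)
        (≤-trans lost≤′ (*-monoˡ-≤ (ℓ * W) (≤-trans (m≤m+n t (suc d)) (≤-reflexive t+d≡T)))) few
      go (no many) = search d (suc t) (M * r) l refined? refl Mrl≡W (trans (sym (+-suc t d)) t+d≡T)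
        lost″ potential″
        where
        open ≤-Reasoning
        lost″ : g * lost refined? (M * r) l ≤ suc t * (ℓ * W)
        lost″ = begin
          g * lost refined? (M * r) l                    ≤⟨ lost-refined ⟩
          g * lost supp? M (r * l) + ℓ * (M * r * l)     ≤⟨ +-mono-≤ lost≤′ (≤-reflexive (cong (ℓ *_) Mrl≡W)) ⟩
          t * (ℓ * W) + ℓ * W                            ≡⟨ +-comm (t * (ℓ * W)) _ ⟩
          suc t * (ℓ * W)                                ∎
        potential″ : c * (2 * (l * ∑ (M * r) (size refined?))) < d * W
        potential″ = +-cancelˡ-< W _ _ (begin-strict
          W + c * (2 * (l * ∑ (M * r) (size refined?)))  ≤⟨ +-monoˡ-≤ _ (<⇒≤ (≰⇒> many)) ⟩
          c * (r * l * unstable) + c * (2 * (l * ∑ (M * r) (size refined?)))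
            ≡⟨ trans (sym (*-distribˡ-+ c _ _)) (cong (c *_) (+-comm (r * l * unstable) _)) ⟩
          c * (2 * (l * ∑ (M * r) (size refined?)) + r * l * unstable)
            ≤⟨ *-monoʳ-≤ c potential-drop ⟩
          c * (2 * (r * l * ∑ M (size supp?)))
            ≡⟨ cong (λ z → c * (2 * (z * ∑ M (size supp?)))) len≡ ⟨
          c * (2 * (leaves ram M (suc d) * b * ∑ M (size supp?)))
            <⟨ potential< ⟩
          suc d * W                                      ≡⟨⟩
          W + d * W                                      ∎)

    -- The search starts from a single node whose support is everything.
    stage-exists : W ≡ leaves ram 1 T * b → c * (2 * ℓ) < T → 0 < W → Stage ram b c W
    stage-exists W≡ T-large W>0 =
      search T 0 1 W {λ _ _ → ⊤} (λ _ _ → yes tt) W≡ (*-identityˡ W) refl lost≤ potential<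
      where
      open ≤-Reasoning
      zero-sum : ∀ n {f : ℕ → ℕ} → (∀ i → i < n → f i ≤ 0) → ∑ n f ≤ 0
      zero-sum n f≤0 = ≤-trans (∑-≤-const n f≤0) (≤-reflexive (*-zeroʳ n))
      lost≤ : g * lost (λ _ _ → yes tt) 1 W ≤ 0
      lost≤ = ≤-trans (*-monoʳ-≤ g (zero-sum 1 λ _ _ → zero-sum W λ _ _ → z≤n)) (≤-reflexive (*-zeroʳ g))
      potential< : c * (2 * (W * ∑ 1 (size {λ _ _ → ⊤} (λ _ _ → yes tt)))) < T * W
      potential< = begin-strict
        c * (2 * (W * ∑ 1 (size {λ _ _ → ⊤} (λ _ _ → yes tt))))
          ≤⟨ *-monoʳ-≤ c (*-monoʳ-≤ 2 (*-monoʳ-≤ W (∑-≤-const 1 λ _ _ → ∑-≤-const ℓ {c = 1} λ _ _ → ≤-refl))) ⟩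
        c * (2 * (W * (1 * (ℓ * 1))))   ≡⟨ rearr c W ℓ ⟩
        c * (2 * ℓ) * W                 <⟨ *-monoˡ-< W ⦃ >-nonZero W>0 ⦄ T-large ⟩
        T * W                           ∎
        where rearr : ∀ c W ℓ → c * (2 * (W * (1 * (ℓ * 1)))) ≡ c * (2 * ℓ) * W
              rearr = solve-∀

-- Cells and their samples

_∈?_ : ∀ x (xs : List ℕ) → Dec (x ∈ xs)
_∈?_ = ∈-decidable _≟_

length-cartesianProduct : ∀ {A B : Set} (xs : List A) (ys : List B) →
                          length (cartesianProduct xs ys) ≡ length xs * length ys
length-cartesianProduct []       ys = refl
length-cartesianProduct (x ∷ xs) ys = trans (length-++ (map (x ,_) ys))
  (cong₂ _+_ (length-map (x ,_) ys) (length-cartesianProduct xs ys))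

∑-𝟙∈-≤ : ∀ n (F : List ℕ) → ∑ n (λ f → 𝟙 (f ∈? F)) ≤ length F
∑-𝟙∈-≤ n []      = ≤-trans (∑-≤-const n λ _ _ → ≤-refl) (≤-reflexive (*-zeroʳ n))
∑-𝟙∈-≤ n (x ∷ F) = begin
  ∑ n (λ f → 𝟙 (f ∈? (x ∷ F)))                        ≤⟨ ∑-mono n (λ f _ → 𝟙-cover (f ∈? (x ∷ F)) (f ≟ x) (f ∈? F) λ { (here p) → inj₁ p ; (there p) → inj₂ p }) ⟩
  ∑ n (λ f → 𝟙 (f ≟ x) + 𝟙 (f ∈? F))                  ≡⟨ ∑-+ n _ _ ⟩
  ∑ n (λ f → 𝟙 (f ≟ x)) + ∑ n (λ f → 𝟙 (f ∈? F))      ≤⟨ +-mono-≤ (∑-𝟙≡-≤1 n x) (∑-𝟙∈-≤ n F) ⟩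
  suc (length F)                                      ∎
  where open ≤-Reasoning

-- Distinct representatives, chosen one after the other: it is enough that every
-- member of the family has a representative outside any `N` forbidden values.
distinctRepresentatives : ∀ {C : Set} (_≟ᶜ_ : (c d : C) → Dec (c ≡ d)) {P : C → ℕ → Set} N (cs : List C) →
  length cs ≤ N → (∀ c F → c ∈ cs → length F ≤ N → ∃[ f ] (f ∉ F × P c f)) →
  Σ[ Y ∈ (C → ℕ) ] ((∀ c → c ∈ cs → P c (Y c)) ×
                    (∀ c d → c ∈ cs → d ∈ cs → c ≢ d → Y c ≢ Y d))
distinctRepresentatives _≟ᶜ_ N [] _ _ = (λ _ → 0) , (λ _ ()) , λ _ _ ()
distinctRepresentatives {C} _≟ᶜ_ {P} N (c ∷ cs) len≤N choose
  with distinctRepresentatives _≟ᶜ_ {P} N cs (≤-trans (n≤1+n _) len≤N) (λ d F d∈ → choose d F (there d∈))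
... | Y , rep , dist
  with choose c (map Y cs) (here refl) (≤-trans (≤-reflexive (length-map Y cs)) (≤-trans (n≤1+n _) len≤N))
...   | f , f∉ , pf = Y′ , rep′ , dist′
  where
  pick : ∀ d → Dec (d ≡ c) → ℕ
  pick d (yes _) = f
  pick d (no _)  = Y d
  Y′ : C → ℕ
  Y′ d = pick d (d ≟ᶜ c)
  tail∈ : ∀ {d} → d ≢ c → d ∈ c ∷ cs → d ∈ cs
  tail∈ d≢c (here d≡c) = contradiction d≡c d≢c
  tail∈ d≢c (there d∈) = d∈
  rep′ : ∀ d → d ∈ c ∷ cs → P d (Y′ d)
  rep′ d d∈ with d ≟ᶜ c
  ... | yes refl = pf
  ... | no d≢c   = rep d (tail∈ d≢c d∈)
  dist′ : ∀ d e → d ∈ c ∷ cs → e ∈ c ∷ cs → d ≢ e → Y′ d ≢ Y′ e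
  dist′ d e d∈ e∈ d≢e with d ≟ᶜ c | e ≟ᶜ c
  ... | yes refl | yes refl = contradiction refl d≢e
  ... | yes refl | no e≢c   = λ f≡ → f∉ (subst (_∈ map Y cs) (sym f≡) (∈-map⁺ Y (tail∈ e≢c e∈)))
  ... | no d≢c   | yes refl = λ ≡f → f∉ (subst (_∈ map Y cs) ≡f (∈-map⁺ Y (tail∈ d≢c d∈)))
  ... | no d≢c   | no e≢c   = dist d e (tail∈ d≢c d∈) (tail∈ e≢c e∈) d≢e

-- The pairs of cells with equal letter: the two nodes and the letter.
pairsOfCells : ℕ → ℕ → List (ℕ × ℕ × ℕ)
pairsOfCells ℓ M = cartesianProduct (upTo M) (cartesianProduct (upTo M) (upTo ℓ))

-- How many children of each of `M` nodes have to be selected to find `κ` among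
-- them that are homogeneous for all pairs of cells.
arity : ℕ → ℕ → ℕ → ℕ
arity ℓ κ M = ramseyNumber (length (pairsOfCells ℓ M)) κ

-- `fine p` is the fine level of the value at position `p`; each coarse level
-- consists of `h` fine levels.
module Samples (n : ℕ) (fine : ℕ → ℕ) (h : ℕ) .⦃ _ : NonZero h ⦄ (L : ℕ) where

  -- The coarse level of the value at a position is its letter.
  coarse : ℕ → ℕ
  coarse p = fine p / h

  -- `κ` samples of each cell `(v , a)`, the node `v` with the coarse level `a`.
  -- Sample `i` is a set of at least `L` points: those of the fine level
  -- `level v a i`, a part of `a`, in the block of `l` positions from `start v i`.
  -- For `i < j` the order of the fine levels of sample `i` of one cell and sample
  -- `j` of another depends on the two cells only.
  record Template (κ : ℕ) (Cell : ℕ → ℕ → Set) : Set where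
    field
      l     : ℕ
      level : ℕ → ℕ → ℕ → ℕ
      start : ℕ → ℕ → ℕ
      level-coarse : ∀ {v a} i → Cell v a → i < κ → level v a i / h ≡ a
      homogeneous  : ∀ {v a w b} i j i′ j′ → Cell v a → Cell w b →
                     i < j → j < κ → i′ < j′ → j′ < κ →
                     level v a i < level w b j → level v a i′ < level w b j′
      distinct     : ∀ {v a w b} i j → Cell v a → Cell w b → i < j → j < κ →
                     level v a i ≢ level w b j
      within       : ∀ {v a} i → Cell v a → i < κ → start v i + l ≤ n
      ordered      : ∀ {v a w b} i j → Cell v a → Cell w b → v ≤ w → i < j → j < κ →
                     start v i + l ≤ start w j
      many         : ∀ {v a} i → Cell v a → i < κ →
                     L ≤ ∑ l (λ x → 𝟙 (fine (start v i + x) ≟ level v a i))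

-- Fine levels have at most `u` points; `m` bounds their number.  By `b-large`, one
-- part in `g` of a block is more than all the points on `N` fine levels together
-- with fewer than `L` points on each fine level.
module Levels (n : ℕ) (fine : ℕ → ℕ) (h : ℕ) .⦃ _ : NonZero h ⦄ (u m L N g b : ℕ)
              (fine<m : ∀ p → fine p < m)
              (class≤u : ∀ f → ∑ n (λ p → 𝟙 (fine p ≟ f)) ≤ u)
              (b-large : g * (N * u + m * L) < b) where

  -- Otherwise the points of the coarse level `a` in the block would all lie in one
  -- of the levels of `F` or in a level with fewer than `L` points of the block.
  popular-level : ∀ lo l a F → lo + l ≤ n → b ≤ l → length F ≤ N →
    l ≤ g * ∑ l (λ i → 𝟙 (fine (lo + i) / h ≟ a)) →
    ∃[ f ] (f ∉ F × f / h ≡ a × L ≤ ∑ l (λ i → 𝟙 (fine (lo + i) ≟ f)))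
  popular-level lo l a F lo+l≤n b≤l lenF dense
    with anyUpTo? (λ f → ¬? (f ∈? F) ×-dec (f / h ≟ a) ×-dec (L ≤? ∑ l (λ i → 𝟙 (fine (lo + i) ≟ f)))) m
  ... | yes (f , _ , found) = f , found
  ... | no none = contradiction dense (<⇒≱ (begin-strict
    g * ∑ l (λ i → 𝟙 (fine (lo + i) / h ≟ a))
      ≤⟨ *-monoʳ-≤ g (∑-mono l λ i _ → spread i) ⟩
    g * ∑ l (λ i → ∑ m (λ f → 𝟙 ((f / h ≟ a) ×-dec (fine (lo + i) ≟ f))))
      ≡⟨ cong (g *_) (∑-swap l m _) ⟩
    g * ∑ m (λ f → ∑ l (λ i → 𝟙 ((f / h ≟ a) ×-dec (fine (lo + i) ≟ f))))
      ≤⟨ *-monoʳ-≤ g (∑-mono m λ f f<m → level f f<m) ⟩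
    g * ∑ m (λ f → u * 𝟙 (f ∈? F) + L)
      ≡⟨ cong (g *_) (trans (∑-+ m _ _) (cong₂ _+_ (sym (*-∑ u m _)) (∑-const m L))) ⟩
    g * (u * ∑ m (λ f → 𝟙 (f ∈? F)) + m * L)
      ≤⟨ *-monoʳ-≤ g (+-monoˡ-≤ (m * L) (≤-trans (*-monoʳ-≤ u (≤-trans (∑-𝟙∈-≤ m F) lenF)) (≤-reflexive (*-comm u N)))) ⟩
    g * (N * u + m * L)
      <⟨ b-large ⟩
    b
      ≤⟨ b≤l ⟩
    l ∎))
    where
    open ≤-Reasoning
    spread : ∀ i → 𝟙 (fine (lo + i) / h ≟ a) ≤ ∑ m (λ f → 𝟙 ((f / h ≟ a) ×-dec (fine (lo + i) ≟ f)))
    spread i = ≤-trans (𝟙-mono _ ((fine (lo + i) / h ≟ a) ×-dec (fine (lo + i) ≟ fine (lo + i))) (_, refl))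
                       (∑-term _ (fine (lo + i)) (fine<m _))
    window : ∀ f → ∑ l (λ i → 𝟙 (fine (lo + i) ≟ f)) ≤ u
    window f = ≤-trans (∑-window lo l (λ p → 𝟙 (fine p ≟ f)) lo+l≤n) (class≤u f)
    level : ∀ f → f < m → ∑ l (λ i → 𝟙 ((f / h ≟ a) ×-dec (fine (lo + i) ≟ f))) ≤ u * 𝟙 (f ∈? F) + L
    level f f<m with f ∈? F | f / h ≟ a | L ≤? ∑ l (λ i → 𝟙 (fine (lo + i) ≟ f))
    ... | yes _  | d | _ = ≤-trans (∑-mono l λ i _ → 𝟙-mono (d ×-dec (fine (lo + i) ≟ f)) (fine (lo + i) ≟ f) proj₂)
                             (≤-trans (window f) (≤-trans (≤-reflexive (sym (*-identityʳ u))) (m≤m+n (u * 1) L)))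
    ... | no f∉ | no ≢a | _ = ≤-trans (∑-mono l λ i _ → ≤-reflexive (𝟙-no (no ≢a ×-dec (fine (lo + i) ≟ f)) (≢a ∘ proj₁)))
                             (≤-trans (≤-reflexive (trans (∑-const l 0) (*-zeroʳ l))) z≤n)
    ... | no f∉ | yes ≡a | yes L≤ = contradiction (f , f<m , f∉ , ≡a , L≤) none
    ... | no f∉ | yes ≡a | no L≰ = ≤-trans (∑-mono l λ i _ → 𝟙-mono (yes ≡a ×-dec (fine (lo + i) ≟ f)) (fine (lo + i) ≟ f) proj₂)
                             (≤-trans (<⇒≤ (≰⇒> L≰)) (m≤n+m L (u * 0)))

  open Samples n fine h L

  module _ (ℓ : ℕ) (coarse<ℓ : ∀ p → coarse p < ℓ) (κ c W : ℕ) (W≤n : W ≤ n) where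

    module _ (stage : Refinement.Stage coarse ℓ coarse<ℓ g (arity ℓ κ) b c W) where
      open Refinement.Stage stage

      -- A letter with a node at which it is active.
      Cell : ℕ → ℕ → Set
      Cell v a = v < M × a < ℓ × Active v a

      template : M * (ℓ * ρ) ≤ N → Template κ Cell
      template cells≤N = record
        { l = l
        ; level = level
        ; start = start
        ; level-coarse = λ i cell i<κ → proj₁ (rep (cell∈ cell (e<ρ i i<κ)))
        ; homogeneous = homogeneous
        ; distinct = λ i j p q i<j j<κ →
            dist (cell∈ p (e<ρ i (<-trans i<j j<κ))) (cell∈ q (e<ρ j j<κ))
              (λ eq → <⇒≢ (e-mono i j i<j j<κ) (cong (proj₂ ∘ proj₂) eq))
        ; within = λ i cell i<κ → within cell (e<ρ i i<κ)
        ; ordered = ordered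
        ; many = λ i cell i<κ → proj₂ (rep (cell∈ cell (e<ρ i i<κ)))
        }
        where
        -- A cell with a selected child `s`, represented by a fine level that is
        -- popular in that child.
        cells : List (ℕ × ℕ × ℕ)
        cells = filter (λ (v , a , s) → Active? v a)
                       (cartesianProduct (upTo M) (cartesianProduct (upTo ℓ) (upTo ρ)))

        block : ℕ → ℕ → ℕ
        block v s = (v * r + child v s) * l

        Represents : ℕ × ℕ × ℕ → ℕ → Set
        Represents (v , a , s) f = f / h ≡ a × L ≤ ∑ l (λ i → 𝟙 (fine (block v s + i) ≟ f))

        cells-length : length cells ≤ N
        cells-length = ≤-trans (length-filter _ (cartesianProduct (upTo M) (cartesianProduct (upTo ℓ) (upTo ρ))))
          (≤-trans (≤-reflexive (trans (length-cartesianProduct (upTo M) _)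
            (cong₂ _*_ (length-upTo M) (trans (length-cartesianProduct (upTo ℓ) (upTo ρ))
              (cong₂ _*_ (length-upTo ℓ) (length-upTo ρ)))))) cells≤N)

        cell∈ : ∀ {v a s} → Cell v a → s < ρ → (v , a , s) ∈ cells
        cell∈ (v<M , a<ℓ , act) s<ρ = ∈-filter⁺ _
          (∈-cartesianProduct⁺ (∈-upTo⁺ v<M) (∈-cartesianProduct⁺ (∈-upTo⁺ a<ℓ) (∈-upTo⁺ s<ρ))) act

        ∈cells : ∀ {v a s} → (v , a , s) ∈ cells → Cell v a × s < ρ
        ∈cells {v} {a} {s} c∈ =
          let all∈ , act = ∈-filter⁻ (λ (v , a , s) → Active? v a) c∈
              v∈ , rest∈ = ∈-cartesianProduct⁻ (upTo M) _ all∈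
              a∈ , s∈    = ∈-cartesianProduct⁻ (upTo ℓ) _ rest∈
          in  (∈-upTo⁻ v∈ , ∈-upTo⁻ a∈ , act) , ∈-upTo⁻ s∈

        next-node : ∀ {v w c} → v < w → c < r → suc (v * r + c) ≤ w * r
        next-node {v} {w} {c} v<w c<r = begin
          suc (v * r + c)  ≡⟨ +-suc (v * r) c ⟨
          v * r + suc c    ≤⟨ +-monoʳ-≤ (v * r) c<r ⟩
          v * r + r        ≡⟨ +-comm (v * r) r ⟩
          suc v * r        ≤⟨ *-monoˡ-≤ r v<w ⟩
          w * r            ∎
          where open ≤-Reasoning

        block-end : ∀ J {J′} → J < J′ → J * l + l ≤ J′ * l
        block-end J J<J′ = ≤-trans (≤-reflexive (+-comm (J * l) l)) (*-monoˡ-≤ l J<J′)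

        within : ∀ {v a s} → Cell v a → s < ρ → block v s + l ≤ n
        within {v} {a} {s} (v<M , _ , act) s<ρ = begin
          block v s + l   ≤⟨ block-end (v * r + child v s) (next-node v<M (child<r v a s act s<ρ)) ⟩
          M * r * l       ≡⟨ *-assoc M r l ⟩
          M * (r * l)     ≡⟨ covers ⟩
          W               ≤⟨ W≤n ⟩
          n               ∎
          where open ≤-Reasoning

        choose : ∀ c F → c ∈ cells → length F ≤ N → ∃[ f ] (f ∉ F × Represents c f)
        choose (v , a , s) F c∈ lenF =
          let cell@(_ , a<ℓ , act) , s<ρ = ∈cells c∈
          in  popular-level (block v s) l a F (within cell s<ρ) b≤l lenF (child-dense v a s act a<ℓ s<ρ)

        representatives = distinctRepresentatives (≡-dec _≟_ (≡-dec _≟_ _≟_)) {Represents} N cells cells-length choose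

        Y : ℕ × ℕ × ℕ → ℕ
        Y = proj₁ representatives

        rep : ∀ {x} → x ∈ cells → Represents x (Y x)
        rep = proj₁ (proj₂ representatives) _

        dist : ∀ {x y} → x ∈ cells → y ∈ cells → x ≢ y → Y x ≢ Y y
        dist = proj₂ (proj₂ representatives) _ _

        homogeneousSubset = ramseyℕ {R = λ (v , w , a) s t → Y (v , a , s) < Y (w , a , t)}
                              (λ (v , w , a) s t → Y (v , a , s) <? Y (w , a , t)) κ (pairsOfCells ℓ M)

        -- The selected children that serve as samples.
        e : ℕ → ℕ
        e = proj₁ homogeneousSubset

        e<ρ : ∀ i → i < κ → e i < ρ
        e<ρ = proj₁ (proj₂ homogeneousSubset)

        e-mono : ∀ i j → i < j → j < κ → e i < e j
        e-mono = proj₁ (proj₂ (proj₂ homogeneousSubset))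

        level : ℕ → ℕ → ℕ → ℕ
        level v a i = Y (v , a , e i)

        start : ℕ → ℕ → ℕ
        start v i = block v (e i)

        homogeneous : ∀ {v a w b} i j i′ j′ → Cell v a → Cell w b →
                      i < j → j < κ → i′ < j′ → j′ < κ →
                      level v a i < level w b j → level v a i′ < level w b j′
        homogeneous {v} {a} {w} {b} i j i′ j′ p@(v<M , a<ℓ , _) q@(w<M , _ , _) i<j j<κ i′<j′ j′<κ <ⱼ = go (a ≟ b)
          where
          go : Dec (a ≡ b) → level v a i′ < level w b j′
          go (yes a≡b) = subst (λ b → level v a i < level w b j → level v a i′ < level w b j′) a≡b
            (All.lookup (proj₂ (proj₂ (proj₂ homogeneousSubset)))
              (∈-cartesianProduct⁺ (∈-upTo⁺ v<M) (∈-cartesianProduct⁺ (∈-upTo⁺ w<M) (∈-upTo⁺ a<ℓ)))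
              i j i′ j′ i<j j<κ i′<j′ j′<κ) <ⱼ
          -- Samples with different letters are compared by their letters.
          go (no a≢b) = ≰⇒> λ ≥ⱼ → a≢b (≤-antisym
            (subst₂ _≤_ (letter i p (<-trans i<j j<κ)) (letter j q j<κ) (/-monoˡ-≤ h (<⇒≤ <ⱼ)))
            (subst₂ _≤_ (letter j′ q j′<κ) (letter i′ p (<-trans i′<j′ j′<κ)) (/-monoˡ-≤ h ≥ⱼ)))
            where
            letter : ∀ {v a} i → Cell v a → i < κ → level v a i / h ≡ a
            letter i cell i<κ = proj₁ (rep (cell∈ cell (e<ρ i i<κ)))

        ordered : ∀ {v a w b} i j → Cell v a → Cell w b → v ≤ w → i < j → j < κ →
                  start v i + l ≤ start w j
        ordered {v} {a} {w} {b} i j (_ , _ , act) (_ , _ , act′) v≤w i<j j<κ =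
          block-end (v * r + child v (e i)) (go (m≤n⇒m<n∨m≡n v≤w))
          where
          go : v < w ⊎ v ≡ w → v * r + child v (e i) < w * r + child w (e j)
          go (inj₁ v<w)  = ≤-trans (next-node v<w (child<r v a (e i) act (e<ρ i (<-trans i<j j<κ)))) (m≤m+n (w * r) _)
          go (inj₂ refl) = +-monoʳ-< (v * r) (child-mono v b (e i) (e j) act′ (e-mono i j i<j j<κ) (e<ρ j j<κ))

-- Permutations as functions on numbers, and linear orders

-- The value of a permutation at a position given as a number, with the junk
-- value 0 past the end.
value : ∀ {n} → Permutation′ n → ℕ → ℕ
value {n} π p with p <? n
... | yes p<n = toℕ (π ⟨$⟩ʳ fromℕ< p<n)
... | no _    = 0

value-toℕ : ∀ {n} (π : Permutation′ n) i → value π (toℕ i) ≡ toℕ (π ⟨$⟩ʳ i)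
value-toℕ {n} π i with toℕ i <? n
... | yes i<n = cong (λ j → toℕ (π ⟨$⟩ʳ j)) (Fin.fromℕ<-toℕ i i<n)
... | no i≮n  = contradiction (Fin.toℕ<n i) i≮n

value-< : ∀ {n} (π : Permutation′ n) p → 0 < n → value π p < n
value-< {n} π p 0<n with p <? n
... | yes p<n = Fin.toℕ<n _
... | no _    = 0<n

opaque
  unfolding ∑

  ∑-value : ∀ {n} (π : Permutation′ n) (f : ℕ → ℕ) → ∑ n (λ p → f (value π p)) ≡ ∑ n f
  ∑-value {n} π f = trans (Sum.sum-cong-≗ {n} λ i → cong f (value-toℕ π i))
                          (sym (Sum.sum-permute (f ∘ toℕ) π))

  footrule-∑ : ∀ {n} (π ρ : Permutation′ n) → footrule π ρ ≡ ∑ n (λ p → ∣ value π p - value ρ p ∣)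
  footrule-∑ {n} π ρ = Sum.sum-cong-≗ {n} λ i → sym (cong₂ ∣_-_∣ (value-toℕ π i) (value-toℕ ρ i))

-- A value is the number of smaller values.
value-rank : ∀ {n} (π : Permutation′ n) p → 0 < n →
             ∑ n (λ q → 𝟙 (value π q <? value π p)) ≡ value π p
value-rank π p 0<n = trans (∑-value π (λ v → 𝟙 (v <? value π p))) (∑-𝟙< (<⇒≤ (value-< π p 0<n)))

injective⇒onto : ∀ {n} (f : Fin n → Fin n) → Injective _≡_ _≡_ f → ∀ j → ∃[ i ] f i ≡ j
injective⇒onto {suc _} f inj j with Fin.any? (λ i → f i Fin.≟ j)
... | yes found = found
... | no none   = contradiction
  (Fin.injective⇒≤ {f = λ i → Fin.punchOut {i = j} {j = f i} (λ eq → none (i , sym eq))}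
    (λ eq → inj (Fin.punchOut-injective {i = j} _ _ eq)))
  1+n≰n

injective⇒permutation : ∀ {n} (f : Fin n → Fin n) → Injective _≡_ _≡_ f →
                        Σ[ π ∈ Permutation′ n ] (∀ i → π ⟨$⟩ʳ i ≡ f i)
injective⇒permutation f inj =
  permutation f (proj₁ ∘ onto) (proj₂ ∘ onto) (λ i → inj (proj₂ (onto (f i)))) , λ _ → refl
  where
  onto = injective⇒onto f inj

-- A decidable strict linear order on the numbers is realised below `n` by the
-- permutation that sends each position to its rank.
rankPermutation : ∀ n {_≺_ : ℕ → ℕ → Set} (_≺?_ : ∀ p q → Dec (p ≺ q)) →
  (∀ p → ¬ p ≺ p) → (∀ p q s → p ≺ q → q ≺ s → p ≺ s) → (∀ p q → p ≢ q → p ≺ q ⊎ q ≺ p) →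
  Σ[ π ∈ Permutation′ n ]
    ((∀ p q → p < n → q < n → p ≺ q → value π p < value π q) ×
     (∀ p q → p < n → q < n → value π p < value π q → p ≺ q))
rankPermutation n {_≺_} _≺?_ irrefl trns total =
  let π , π≡ = injective⇒permutation rankᶠ injective
      value≡ : ∀ i → value π (toℕ i) ≡ rank (toℕ i)
      value≡ i = trans (value-toℕ π i) (trans (cong toℕ (π≡ i)) (toℕ-rank i))
      mono : ∀ i j → toℕ i ≺ toℕ j → value π (toℕ i) < value π (toℕ j)
      mono i j i≺j = subst₂ _<_ (sym (value≡ i)) (sym (value≡ j)) (rank-mono i i≺j)
      mono-< : ∀ p q → p < n → q < n → p ≺ q → value π p < value π q
      mono-< p q p<n q<n p≺q =
        subst₂ (λ p q → value π p < value π q) (Fin.toℕ-fromℕ< p<n) (Fin.toℕ-fromℕ< q<n)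
          (mono (fromℕ< p<n) (fromℕ< q<n)
            (subst₂ _≺_ (sym (Fin.toℕ-fromℕ< p<n)) (sym (Fin.toℕ-fromℕ< q<n)) p≺q))
  in  π , mono-< , λ p q p<n q<n vp<vq →
        [ (λ p≺q → p≺q) , (λ q≺p → contradiction (mono-< q p q<n p<n q≺p) (<-asym vp<vq)) ]′
          (total p q λ p≡q → <⇒≢ vp<vq (cong (value π) p≡q))
  where
  rank : ℕ → ℕ
  rank p = ∑ n (λ q → 𝟙 (q ≺? p))
  rank-mono : ∀ i {q} → toℕ i ≺ q → rank (toℕ i) < rank q
  rank-mono i {q} i≺q = ∑-mono-< n (λ s _ → 𝟙-mono (s ≺? toℕ i) (s ≺? q) (λ s≺i → trns s (toℕ i) q s≺i i≺q))
    (toℕ i) (Fin.toℕ<n i) (≤-reflexive (trans (cong suc (𝟙-no (toℕ i ≺? toℕ i) (irrefl (toℕ i)))) (sym (𝟙-yes (toℕ i ≺? q) i≺q))))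
  rank-< : ∀ i → rank (toℕ i) < n
  rank-< i = ≤-trans (∑-mono-< n {g = λ _ → 1} (λ s _ → 𝟙≤1 (s ≺? toℕ i)) (toℕ i) (Fin.toℕ<n i)
      (≤-reflexive (cong suc (𝟙-no (toℕ i ≺? toℕ i) (irrefl (toℕ i))))))
    (≤-reflexive (trans (∑-const n 1) (*-identityʳ n)))
  rankᶠ : Fin n → Fin n
  rankᶠ i = fromℕ< (rank-< i)
  toℕ-rank : ∀ i → toℕ (rankᶠ i) ≡ rank (toℕ i)
  toℕ-rank i = Fin.toℕ-fromℕ< (rank-< i)
  injective : Injective _≡_ _≡_ rankᶠ
  injective {i} {j} eq with i Fin.≟ j
  ... | yes i≡j = i≡j
  ... | no i≢j with total (toℕ i) (toℕ j) (i≢j ∘ Fin.toℕ-injective)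
  ...   | inj₁ i≺j = contradiction (trans (sym (toℕ-rank i)) (trans (cong toℕ eq) (toℕ-rank j))) (<⇒≢ (rank-mono i i≺j))
  ...   | inj₂ j≺i = contradiction (trans (sym (toℕ-rank j)) (trans (cong toℕ (sym eq)) (toℕ-rank i))) (<⇒≢ (rank-mono j j≺i))

∣-∣-≤ : ∀ {m n o} → m ≤ n + o → n ≤ m + o → ∣ m - n ∣ ≤ o
∣-∣-≤ {m} {n} {o} m≤n+o n≤m+o with ≤-total m n
... | inj₁ m≤n = ≤-trans (≤-reflexive (m≤n⇒∣m-n∣≡n∸m m≤n)) (m≤n+o⇒m∸n≤o n m n≤m+o)
... | inj₂ n≤m = ≤-trans (≤-reflexive (m≤n⇒∣n-m∣≡n∸m n≤m)) (m≤n+o⇒m∸n≤o m n m≤n+o)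

-- An increasing sequence reflects the order and is injective.
module Increasing {k : ℕ} (f : Fin k → ℕ) (mono : ∀ i j → i Fin.< j → f i < f j) where

  reflects : ∀ i j → f i < f j → i Fin.< j
  reflects i j fi<fj with Fin.<-cmp i j
  ... | tri< i<j _ _  = i<j
  ... | tri≈ _ refl _ = contradiction fi<fj (<-irrefl refl)
  ... | tri> _ _ j<i  = contradiction (mono j i j<i) (<-asym fi<fj)

  reflects-≡ : ∀ i j → f i ≡ f j → i ≡ j
  reflects-≡ i j fi≡fj with Fin.<-cmp i j
  ... | tri< i<j _ _ = contradiction fi≡fj (<⇒≢ (mono i j i<j))
  ... | tri≈ _ i≡j _ = i≡j
  ... | tri> _ _ j<i = contradiction (sym fi≡fj) (<⇒≢ (mono j i j<i))

<-distinct⇒distinct : ∀ {k} (y : Fin k → ℕ) → (∀ i j → i Fin.< j → y i ≢ y j) → ∀ i j → i ≢ j → y i ≢ y j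
<-distinct⇒distinct y distinct i j i≢j with Fin.<-cmp i j
... | tri< i<j _ _ = distinct i j i<j
... | tri≈ _ i≡j _ = contradiction i≡j i≢j
... | tri> _ _ j<i = distinct j i j<i ∘ sym

-- If two permutations agree on the order of any two good positions in different
-- classes, then at a good position their values differ by at most the number of
-- bad positions and the size of a class.
footrule-≤ : ∀ {n} (π ρ : Permutation′ n) (class : ℕ → ℕ) {Good : ℕ → Set} (Good? : ∀ p → Dec (Good p)) B w →
  0 < n →
  ∑ n (λ p → 𝟙 (¬? (Good? p))) ≤ B →
  (∀ a → ∑ n (λ p → 𝟙 (class p ≟ a)) ≤ w) →
  (∀ p q → p < n → q < n → Good p → Good q → class p < class q → value π p < value π q × value ρ p < value ρ q) →
  footrule π ρ ≤ n * (B + w) + n * B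
footrule-≤ {n} π ρ class {Good} Good? B w 0<n bad≤ class≤ agree = begin
  footrule π ρ                                                  ≡⟨ footrule-∑ π ρ ⟩
  ∑ n (λ p → ∣ value π p - value ρ p ∣)                         ≤⟨ ∑-mono n position ⟩
  ∑ n (λ p → (B + w) + n * 𝟙 (¬? (Good? p)))                    ≡⟨ trans (∑-+ n _ _) (cong₂ _+_ (∑-const n _) (sym (*-∑ n n _))) ⟩
  n * (B + w) + n * ∑ n (λ p → 𝟙 (¬? (Good? p)))                ≤⟨ +-monoʳ-≤ (n * (B + w)) (*-monoʳ-≤ n bad≤) ⟩
  n * (B + w) + n * B                                           ∎
  where
  open ≤-Reasoning
  rank-≤ : ∀ (π ρ : Permutation′ n) →
    (∀ p q → p < n → q < n → Good p → Good q → class p < class q → value π p < value π q × value ρ p < value ρ q) →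
    ∀ p → p < n → Good p → value π p ≤ value ρ p + (B + w)
  rank-≤ π ρ agree p p<n gp = begin
    value π p                                   ≡⟨ value-rank π p 0<n ⟨
    ∑ n (λ q → 𝟙 (value π q <? value π p))      ≤⟨ ∑-mono n pairwise ⟩
    ∑ n (λ q → 𝟙 (value ρ q <? value ρ p) + (𝟙 (¬? (Good? q)) + 𝟙 (class q ≟ class p)))
      ≡⟨ trans (∑-+ n _ _) (cong₂ _+_ (value-rank ρ p 0<n) (∑-+ n _ _)) ⟩
    value ρ p + (∑ n (λ q → 𝟙 (¬? (Good? q))) + ∑ n (λ q → 𝟙 (class q ≟ class p)))
      ≤⟨ +-monoʳ-≤ (value ρ p) (+-mono-≤ bad≤ (class≤ (class p))) ⟩
    value ρ p + (B + w)                         ∎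
    where
    pairwise : ∀ q → q < n → 𝟙 (value π q <? value π p) ≤
              𝟙 (value ρ q <? value ρ p) + (𝟙 (¬? (Good? q)) + 𝟙 (class q ≟ class p))
    pairwise q q<n with Good? q
    ... | no _  = ≤-trans (𝟙≤1 _) (≤-trans (m≤m+n 1 _) (m≤n+m _ _))
    ... | yes gq with <-cmp (class q) (class p)
    ...   | tri< q<p _ _ = ≤-trans (𝟙-mono _ (value ρ q <? value ρ p) λ _ → proj₂ (agree q p q<n p<n gq gp q<p)) (m≤m+n _ _)
    ...   | tri≈ _ q≡p _ = ≤-trans (𝟙≤1 _) (≤-trans (≤-reflexive (sym (𝟙-yes (class q ≟ class p) q≡p))) (m≤n+m _ _))
    ...   | tri> _ _ p<q = ≤-trans (≤-reflexive (𝟙-no (value π q <? value π p)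
                             λ vq<vp → <-asym vq<vp (proj₁ (agree p q p<n q<n gp gq p<q)))) z≤n
  position : ∀ p → p < n → ∣ value π p - value ρ p ∣ ≤ (B + w) + n * 𝟙 (¬? (Good? p))
  position p p<n with Good? p
  ... | yes gp = ≤-trans (∣-∣-≤ (rank-≤ π ρ agree p p<n gp)
                   (rank-≤ ρ π (λ p q p<n q<n gp gq c<c → let a , b = agree p q p<n q<n gp gq c<c in b , a) p p<n gp)) (m≤m+n _ _)
  ... | no _   = ≤-trans (∣-∣-≤ {value π p} {value ρ p} {n}
                   (≤-trans (<⇒≤ (value-< π p 0<n)) (m≤n+m n _)) (≤-trans (<⇒≤ (value-< ρ p 0<n)) (m≤n+m n _)))
                   (≤-trans (≤-reflexive (sym (*-identityʳ n))) (m≤n+m (n * 1) _))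

-- Positions compared through samples: position `p` has sample values
-- `y p 0 , y p 1 , …`, and the order of `y p i` and `y q j` for `p < q` and
-- `i < j` depends on `p` and `q` only.
module SampleOrder (y : ℕ → ℕ → ℕ) (κ : ℕ) (4≤κ : 4 ≤ κ)
  (homogeneous : ∀ {p q} i j i′ j′ → p < q → i < j → j < κ → i′ < j′ → j′ < κ → y p i < y q j → y p i′ < y q j′)
  (distinct : ∀ {p q} i j → p < q → i < j → j < κ → y p i ≢ y q j) where

  -- Positions are compared by the samples 0 and 1, the smaller index going to the
  -- smaller position.
  _≺_ : ℕ → ℕ → Set
  p ≺ q = (p < q × y p 0 < y q 1) ⊎ (q < p × y p 1 < y q 0)

  _≺?_ : ∀ p q → Dec (p ≺ q)
  p ≺? q = ((p <? q) ×-dec (y p 0 <? y q 1)) ⊎-dec ((q <? p) ×-dec (y p 1 <? y q 0))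

  1<κ : 1 < κ
  1<κ = ≤-trans (s≤s (s≤s z≤n)) 4≤κ

  homogeneous-> : ∀ {p q} i j i′ j′ → p < q → i < j → j < κ → i′ < j′ → j′ < κ → y q j < y p i → y q j′ < y p i′
  homogeneous-> {p} {q} i j i′ j′ p<q i<j j<κ i′<j′ j′<κ > with <-cmp (y p i′) (y q j′)
  ... | tri< <′ _ _ = contradiction (homogeneous i′ j′ i j p<q i′<j′ j′<κ i<j j<κ <′) (<-asym >)
  ... | tri≈ _ ≡′ _ = contradiction ≡′ (distinct i′ j′ p<q i′<j′ j′<κ)
  ... | tri> _ _ >′ = >′

  -- The indices `i`, `j` are ordered as the positions `p`, `q`.
  SameOrder : ℕ → ℕ → ℕ → ℕ → Set
  SameOrder p q i j = (p < q → i < j) × (q < p → j < i)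

  ≺⇒< : ∀ {p q i j} → SameOrder p q i j → i < κ → j < κ → p ≺ q → y p i < y q j
  ≺⇒< {i = i} {j} (up , _) i<κ j<κ (inj₁ (p<q , y<)) = homogeneous 0 1 i j p<q z<s 1<κ (up p<q) j<κ y<
  ≺⇒< {i = i} {j} (_ , dn) i<κ j<κ (inj₂ (q<p , y<)) = homogeneous-> 0 1 j i q<p z<s 1<κ (dn q<p) i<κ y<

  <⇒≺ : ∀ {p q i j} → SameOrder p q i j → i < κ → j < κ → p ≢ q → y p i < y q j → p ≺ q
  <⇒≺ {p} {q} {i} {j} (up , dn) i<κ j<κ p≢q y< with <-cmp p q
  ... | tri< p<q _ _ = inj₁ (p<q , homogeneous i j 0 1 p<q (up p<q) j<κ z<s 1<κ y<)
  ... | tri≈ _ p≡q _ = contradiction p≡q p≢q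
  ... | tri> _ _ q<p = inj₂ (q<p , homogeneous-> j i 0 1 q<p (dn q<p) i<κ z<s 1<κ y<)

  ≺-irrefl : ∀ p → ¬ p ≺ p
  ≺-irrefl p (inj₁ (p<p , _)) = <-irrefl refl p<p
  ≺-irrefl p (inj₂ (p<p , _)) = <-irrefl refl p<p

  ≺-asym : ∀ p q → p ≺ q → ¬ q ≺ p
  ≺-asym p q (inj₁ (_ , y<))   (inj₂ (_ , y>))   = <-asym y< y>
  ≺-asym p q (inj₂ (_ , y<))   (inj₁ (_ , y>))   = <-asym y< y>
  ≺-asym p q (inj₁ (p<q , _))  (inj₁ (q<p , _))  = <-asym p<q q<p
  ≺-asym p q (inj₂ (q<p , _))  (inj₂ (p<q , _))  = <-asym p<q q<p

  ≺-total : ∀ p q → p ≢ q → p ≺ q ⊎ q ≺ p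
  ≺-total p q p≢q with <-cmp p q
  ... | tri≈ _ p≡q _ = contradiction p≡q p≢q
  ... | tri< p<q _ _ with <-cmp (y p 0) (y q 1)
  ...   | tri< y< _ _ = inj₁ (inj₁ (p<q , y<))
  ...   | tri≈ _ y≡ _ = contradiction y≡ (distinct 0 1 p<q z<s 1<κ)
  ...   | tri> _ _ y> = inj₂ (inj₂ (p<q , y>))
  ≺-total p q p≢q | tri> _ _ q<p with <-cmp (y q 0) (y p 1)
  ...   | tri< y< _ _ = inj₂ (inj₁ (q<p , y<))
  ...   | tri≈ _ y≡ _ = contradiction y≡ (distinct 0 1 q<p z<s 1<κ)
  ...   | tri> _ _ y> = inj₁ (inj₂ (q<p , y>))

  -- Three positions are represented by samples with indices in the order of the
  -- positions, and the sample values are linearly ordered.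
  ≺-trans : ∀ p q s → p ≺ q → q ≺ s → p ≺ s
  ≺-trans p q s p≺q q≺s = <⇒≺ (σ-p s , σ-s p) (σ<κ p) (σ<κ s) p≢s
    (<-trans (≺⇒< (σ-p q , σ-q p) (σ<κ p) (σ<κ q) p≺q) (≺⇒< (σ-q s , σ-s q) (σ<κ q) (σ<κ s) q≺s))
    where
    p≢s : p ≢ s
    p≢s refl = ≺-asym p q p≺q q≺s
    σ : ℕ → ℕ
    σ x = 𝟙 (p <? x) + 𝟙 (q <? x) + 𝟙 (s <? x)
    σ<κ : ∀ x → σ x < κ
    σ<κ x = ≤-trans (s≤s (+-mono-≤ (+-mono-≤ (𝟙≤1 (p <? x)) (𝟙≤1 (q <? x))) (𝟙≤1 (s <? x)))) 4≤κ
    weak : ∀ z {x x′} → x < x′ → 𝟙 (z <? x) ≤ 𝟙 (z <? x′)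
    weak z x<x′ = 𝟙-mono (z <? _) (z <? _) λ z<x → <-trans z<x x<x′
    strict : ∀ {x x′} → x < x′ → 𝟙 (x <? x) < 𝟙 (x <? x′)
    strict {x} {x′} x<x′ = ≤-reflexive (trans (cong suc (𝟙-no (x <? x) (<-irrefl refl))) (sym (𝟙-yes (x <? x′) x<x′)))
    σ-p : ∀ x → p < x → σ p < σ x
    σ-p x p<x = +-mono-<-≤ (+-mono-<-≤ (strict p<x) (weak q p<x)) (weak s p<x)
    σ-q : ∀ x → q < x → σ q < σ x
    σ-q x q<x = +-mono-<-≤ (+-mono-≤-< (weak p q<x) (strict q<x)) (weak s q<x)
    σ-s : ∀ x → s < x → σ s < σ x
    σ-s x s<x = +-mono-≤-< (+-mono-≤ (weak p s<x) (weak q s<x)) (strict s<x)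

-- The last position from 1 to `p` at which `P` holds; `z` if there is none.
lastBefore : ∀ {P : ℕ → Set} (P? : ∀ p → Dec (P p)) → ℕ → ℕ → ℕ
lastBefore P? z zero    = z
lastBefore P? z (suc p) with P? (suc p)
... | yes _ = suc p
... | no _  = lastBefore P? z p

-- With the least position of `P` as default, the result always satisfies `P` and
-- is monotone in `p`.
module LastBefore {P : ℕ → Set} (P? : ∀ p → Dec (P p)) {z : ℕ} (Pz : P z) (least : ∀ p → P p → z ≤ p) where

  satisfies : ∀ p → P (lastBefore P? z p)
  satisfies zero    = Pz
  satisfies (suc p) with P? (suc p)
  ... | yes Pp = Pp
  ... | no _   = satisfies p

  fixes : ∀ p → P p → lastBefore P? z p ≡ p
  fixes zero    P0 = n≤0⇒n≡0 (least 0 P0)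
  fixes (suc p) Pp with P? (suc p)
  ... | yes _  = refl
  ... | no ¬Pp = contradiction Pp ¬Pp

  bound : ∀ p q → p ≤ q → P q → lastBefore P? z p ≤ q
  bound zero    q _   Pq = least q Pq
  bound (suc p) q p<q Pq with P? (suc p)
  ... | yes _ = p<q
  ... | no _  = bound p q (<⇒≤ p<q) Pq

  mono : ∀ {p q} → p ≤ q → lastBefore P? z p ≤ lastBefore P? z q
  mono {p} {q} p≤q = go q (≤⇒≤′ p≤q)
    where
    go : ∀ q → p ≤′ q → lastBefore P? z p ≤ lastBefore P? z q
    go _       ≤′-refl       = ≤-refl
    go (suc q) (≤′-step p≤q) with P? (suc q)
    ... | yes Pq = bound p (suc q) (m≤n⇒m≤1+n (≤′⇒≤ p≤q)) Pq
    ... | no _   = go q p≤q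

least : ∀ {P : ℕ → Set} (P? : ∀ p → Dec (P p)) n → P n → ∃[ z ] (P z × (∀ p → P p → z ≤ p))
least P? zero    P0 = 0 , P0 , λ _ _ → z≤n
least {P} P? (suc n) Pn with P? 0
... | yes P0 = 0 , P0 , λ _ _ → z≤n
... | no ¬P0 with least (P? ∘ suc) n Pn
...   | z , Pz , min = suc z , Pz , λ { zero P0 → contradiction P0 ¬P0 ; (suc p) Pp → s≤s (min p Pp) }

-- Counting copies of a pattern

nthSmallest-mono : ∀ {n} (K : Subset n) {i j} → i Fin.< j → nthSmallest K i Fin.< nthSmallest K j
nthSmallest-mono (inside  ∷ K) {zero}  {suc j} _         = z<s
nthSmallest-mono (inside  ∷ K) {suc i} {suc j} (s<s i<j) = s<s (nthSmallest-mono K i<j)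
nthSmallest-mono (outside ∷ K) i<j = s<s (nthSmallest-mono K i<j)

length-filter-map : ∀ {A B : Set} {P : B → Set} (P? : ∀ x → Dec (P x)) (f : A → B) xs →
                    length (filter P? (map f xs)) ≡ length (filter (P? ∘ f) xs)
length-filter-map P? f [] = refl
length-filter-map P? f (x ∷ xs) with P? (f x)
... | yes _ = cong suc (length-filter-map P? f xs)
... | no _  = length-filter-map P? f xs

-- The product of a finite family.
∏ : ∀ {k} → (Fin k → ℕ) → ℕ
∏ {zero}  s = 1
∏ {suc k} s = s zero * ∏ (s ∘ suc)

∏-const : ∀ k L → ∏ {k} (λ _ → L) ≡ L ^ k
∏-const zero    L = refl
∏-const (suc k) L = cong (L *_) (∏-const k L)

-- `K` consists of one element of each of the sets `Z 0 , … , Z (k - 1)`, in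
-- increasing order.
Transversal : ∀ {k n} → (Fin k → ℕ → Set) → Subset n → Set
Transversal {k} Z K = Σ[ ∣K∣≡k ∈ ∣ K ∣ ≡ k ] (∀ i → Z i (toℕ (nthSmallest K (cast (sym ∣K∣≡k) i))))

-- If the sets lie to the right of one another, every choice of one element from
-- each is a transversal, so there are at least as many as the product of the
-- sizes.  The induction decides whether position 0 is chosen.
count-transversals : ∀ k n {Z : Fin k → ℕ → Set} (Z? : ∀ i p → Dec (Z i p)) (s : Fin k → ℕ) →
  (∀ i j p q → i Fin.< j → Z i p → Z j q → p < q) →
  (∀ i → s i ≤ ∑ n (λ p → 𝟙 (Z? i p))) →
  {P : Subset n → Set} (P? : ∀ K → Dec (P K)) → (∀ K → Transversal Z K → P K) →
  ∏ s ≤ length (filter P? (subsets n))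
count-transversals zero    zero    Z? s apart size≤ P? sound =
  ≤-reflexive (sym (cong length (filter-accept P? {xs = []} (sound [] (refl , λ ())))))
count-transversals (suc k) zero    {Z} Z? s apart size≤ P? sound =
  ≤-trans (*-monoˡ-≤ (∏ (s ∘ suc)) (≤-trans (size≤ zero) (≤-reflexive (∑-zero _)))) z≤n
count-transversals k (suc n) {Z} Z? s apart size≤ {P} P? sound = ≤-trans (go k Z? s apart size≤ sound)
  (≤-reflexive (sym (trans (cong length (filter-++ P? (map (inside ∷_) (subsets n)) _))
    (trans (length-++ (filter P? (map (inside ∷_) (subsets n))))
      (cong₂ _+_ (length-filter-map P? (inside ∷_) (subsets n)) (length-filter-map P? (outside ∷_) (subsets n)))))))
  where
  #in #out : ℕ
  #in  = length (filter (P? ∘ (inside ∷_)) (subsets n))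
  #out = length (filter (P? ∘ (outside ∷_)) (subsets n))
  go : ∀ k {Z : Fin k → ℕ → Set} (Z? : ∀ i p → Dec (Z i p)) (s : Fin k → ℕ) →
       (∀ i j p q → i Fin.< j → Z i p → Z j q → p < q) →
       (∀ i → s i ≤ ∑ (suc n) (λ p → 𝟙 (Z? i p))) →
       (∀ K → Transversal Z K → P K) →
       ∏ s ≤ #in + #out
  go zero Z? s apart size≤ sound = ≤-trans
    (count-transversals 0 n (λ i → Z? i ∘ suc) s (λ ()) (λ ()) (P? ∘ (outside ∷_))
      (λ K (eq , _) → sound (outside ∷ K) (eq , λ ())))
    (m≤n+m _ _)
  go (suc k) {Z} Z? s apart size≤ sound with s zero in s₀≡
  ... | zero  = z≤n
  ... | suc t = split (Z? zero 0)
    where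
    -- The set `Z 0` is not empty, so no other set contains position 0.
    nonempty : ∃[ p ] (p < suc n × Z zero p)
    nonempty = ∑-witness (suc n) (Z? zero) (≤-trans (s≤s z≤n) (≤-trans (≤-reflexive (sym s₀≡)) (size≤ zero)))
    size-suc : ∀ i → s (suc i) ≤ ∑ n (λ p → 𝟙 (Z? (suc i) (suc p)))
    size-suc i = ≤-trans (size≤ (suc i)) (≤-reflexive (trans (∑-suc n _)
      (cong (_+ ∑ n (λ p → 𝟙 (Z? (suc i) (suc p))))
        (𝟙-no (Z? (suc i) 0) λ z₀ → contradiction (apart zero (suc i) _ 0 z<s (proj₂ (proj₂ nonempty)) z₀) λ ()))))
    size-zero : suc t ≤ 𝟙 (Z? zero 0) + ∑ n (λ p → 𝟙 (Z? zero (suc p)))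
    size-zero = ≤-trans (≤-reflexive (sym s₀≡)) (≤-trans (size≤ zero) (≤-reflexive (∑-suc n _)))
    apart-suc : ∀ i j p q → i Fin.< j → Z i (suc p) → Z j (suc q) → p < q
    apart-suc i j p q i<j zp zq = s<s⁻¹ (apart i j (suc p) (suc q) i<j zp zq)
    without : ∀ t → t ≤ ∑ n (λ p → 𝟙 (Z? zero (suc p))) → t * ∏ (s ∘ suc) ≤ #out
    without t t≤ = count-transversals (suc k) n (λ i → Z? i ∘ suc) (λ { zero → t ; (suc i) → s (suc i) })
      apart-suc (λ { zero → t≤ ; (suc i) → size-suc i }) (P? ∘ (outside ∷_))
      (λ K (eq , zs) → sound (outside ∷ K) (eq , zs))
    split : Dec (Z zero 0) → suc t * ∏ (s ∘ suc) ≤ #in + #out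
    split (no ¬z₀) = ≤-trans
      (without (suc t) (≤-trans size-zero (≤-reflexive (cong (_+ ∑ n (λ p → 𝟙 (Z? zero (suc p)))) (𝟙-no (Z? zero 0) ¬z₀)))))
      (m≤n+m _ _)
    split (yes z₀) = +-mono-≤
      (count-transversals k n (λ i → Z? (suc i) ∘ suc) (s ∘ suc)
        (λ i j p q i<j → apart-suc (suc i) (suc j) p q (s<s i<j)) size-suc (P? ∘ (inside ∷_))
        (λ K (eq , zs) → sound (inside ∷ K) (cong suc eq , λ { zero → z₀ ; (suc i) → zs i })))
      (without t (s≤s⁻¹ (≤-trans size-zero (≤-reflexive (cong (_+ ∑ n (λ p → 𝟙 (Z? zero (suc p)))) (𝟙-yes (Z? zero 0) z₀))))))

-- The number of copies of `A` in `π`.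
copies : ∀ {k n} → Permutation′ k → Permutation′ n → ℕ
copies A π = length (filter (induces? A π) (subsets _))

-- Blocks to the right of one another, with at least `L` points of each on one
-- level and these levels pairwise different, give `L ^ k` copies of the pattern
-- formed by the levels.
count-copies : ∀ {k n} (A : Permutation′ k) (π : Permutation′ n) (fine : ℕ → ℕ) (l L : ℕ) (lo y : Fin k → ℕ) →
  (∀ p q → fine p < fine q → value π p < value π q) →
  (∀ i → lo i + l ≤ n) → (∀ i j → i Fin.< j → lo i + l ≤ lo j) →
  (∀ i → L ≤ ∑ l (λ x → 𝟙 (fine (lo i + x) ≟ y i))) →
  (∀ i j → i ≢ j → y i ≢ y j) →
  (∀ i j → (A ⟨$⟩ʳ i Fin.< A ⟨$⟩ʳ j) ⇔ (y i < y j)) →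
  L ^ k ≤ copies A π
count-copies {k} {n} A π fine l L lo y fine-mono lo≤n lo-mono many y-distinct pattern′ =
  subst (_≤ _) (∏-const k L)
    (count-transversals k n Z? (λ _ → L) apart size≤ (induces? A π) sound)
  where
  Z : Fin k → ℕ → Set
  Z i p = fine p ≡ y i × lo i ≤ p × p < lo i + l
  Z? : ∀ i p → Dec (Z i p)
  Z? i p = (fine p ≟ y i) ×-dec (lo i ≤? p) ×-dec (p <? lo i + l)
  apart : ∀ i j p q → i Fin.< j → Z i p → Z j q → p < q
  apart i j p q i<j (_ , _ , p<) (_ , ≤q , _) = <-≤-trans p< (≤-trans (lo-mono i j i<j) ≤q)
  size≤ : ∀ i → L ≤ ∑ n (λ p → 𝟙 (Z? i p))
  size≤ i = ≤-trans (many i) (≤-trans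
    (∑-mono l λ x x<l → 𝟙-mono _ (Z? i (lo i + x)) λ eq → eq , m≤m+n (lo i) x , +-monoʳ-< (lo i) x<l)
    (∑-window (lo i) l (λ p → 𝟙 (Z? i p)) (lo≤n i)))
  sound : ∀ K → Transversal Z K → Induces A π K
  sound K (∣K∣≡k , zs) = ∣K∣≡k , λ i j → mk⇔ (to i j) (from i j)
    where
    elem : Fin k → Fin n
    elem i = nthSmallest K (cast (sym ∣K∣≡k) i)
    below : ∀ i j → y i < y j → π ⟨$⟩ʳ elem i Fin.< π ⟨$⟩ʳ elem j
    below i j yi<yj = subst₂ _<_ (value-toℕ π (elem i)) (value-toℕ π (elem j))
      (fine-mono _ _ (subst₂ _<_ (sym (proj₁ (zs i))) (sym (proj₁ (zs j))) yi<yj))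
    to : ∀ i j → A ⟨$⟩ʳ i Fin.< A ⟨$⟩ʳ j → π ⟨$⟩ʳ elem i Fin.< π ⟨$⟩ʳ elem j
    to i j Ai<Aj = below i j (Equivalence.to (pattern′ i j) Ai<Aj)
    from : ∀ i j → π ⟨$⟩ʳ elem i Fin.< π ⟨$⟩ʳ elem j → A ⟨$⟩ʳ i Fin.< A ⟨$⟩ʳ j
    from i j πi<πj with <-cmp (y i) (y j)
    ... | tri< y< _ _ = Equivalence.from (pattern′ i j) y<
    ... | tri> _ _ y> = contradiction (below j i y>) (<-asym πi<πj)
    ... | tri≈ _ y≡ _ with i Fin.≟ j
    ...   | yes refl = contradiction πi<πj (<-irrefl refl)
    ...   | no i≢j   = contradiction y≡ (y-distinct i j i≢j)

-- The rearranged permutation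

ramseyNumber≢0 : ∀ c κ .⦃ _ : NonZero κ ⦄ → NonZero (ramseyNumber c κ)
ramseyNumber≢0 zero    κ ⦃ κ≢0 ⦄ = >-nonZero (>-nonZero⁻¹ κ)
ramseyNumber≢0 (suc c) κ = m^n≢0 2 (ramseyNumber c κ + ramseyNumber c κ)

/-cancel-< : ∀ {m n} o .⦃ _ : NonZero o ⦄ → m / o < n / o → m < n
/-cancel-< o m/o<n/o = ≰⇒> λ n≤m → <⇒≱ m/o<n/o (/-monoˡ-≤ o n≤m)

-- The rearrangement determined by a template, when each good position lies in a
-- cell.  Fine levels have width `u`, coarse levels width `u * h`.
module Rearrangement {k n : ℕ} (A : Permutation′ k) (π : Permutation′ n) (0<n : 0 < n)
  (u h L : ℕ) .⦃ u≢0 : NonZero u ⦄ .⦃ h≢0 : NonZero h ⦄ where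

  -- Samples for the `k` positions of a pattern; four are enough for transitivity.
  κ : ℕ
  κ = k + 4

  fine : ℕ → ℕ
  fine p = value π p / u

  open Samples n fine h L public

  -- Values are distinct, so a level has at most as many points as its width.
  class≤u : ∀ f → ∑ n (λ p → 𝟙 (fine p ≟ f)) ≤ u
  class≤u f = ≤-trans (≤-reflexive (∑-value π (λ v → 𝟙 (v / u ≟ f)))) (∑-𝟙/-≤ n u f)

  coarse-class≤ : ∀ a → ∑ n (λ p → 𝟙 (coarse p ≟ a)) ≤ u * h
  coarse-class≤ a = ≤-trans (≤-reflexive (∑-value π (λ v → 𝟙 (v / u / h ≟ a))))
    (≤-trans (∑-mono n λ v _ → 𝟙-mono _ (v / (u * h) ≟ a) (trans (sym (m/n/o≡m/[n*o] v u h)))) (∑-𝟙/-≤ n (u * h) a))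
    where
    instance
      uh≢0 : NonZero (u * h)
      uh≢0 = m*n≢0 u h

  module _ {Cell : ℕ → ℕ → Set} (template : Template κ Cell) (node : ℕ) .⦃ _ : NonZero node ⦄
           {Good : ℕ → Set} (Good? : ∀ p → Dec (Good p))
           (Good-cell : ∀ p → Good p → Cell (p / node) (coarse p))
           {z : ℕ} (good-z : Good z) (least-z : ∀ p → Good p → z ≤ p) where

    open Template template
    open LastBefore Good? good-z least-z

    -- A bad position is treated as if it were at the last good position before it,
    -- or at the first good position.
    anchor : ℕ → ℕ
    anchor = lastBefore Good? z

    -- The cell to which a position is assigned.
    column letter : ℕ → ℕ
    column p = anchor p / node
    letter p = coarse (anchor p)

    cell : ∀ p → Cell (column p) (letter p)
    cell p = Good-cell (anchor p) (satisfies p)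

    -- The fine levels of the samples of that cell.
    sample : ℕ → ℕ → ℕ
    sample p i = level (column p) (letter p) i

    open SampleOrder sample κ (m≤n+m 4 k)
      (λ {p} {q} i j i′ j′ _ → homogeneous i j i′ j′ (cell p) (cell q))
      (λ {p} {q} i j _ → distinct i j (cell p) (cell q))

    -- The permutation whose values are in the order given by the samples.
    π̃-spec : Σ[ π̃ ∈ Permutation′ n ]
      ((∀ p q → p < n → q < n → p ≺ q → value π̃ p < value π̃ q) ×
       (∀ p q → p < n → q < n → value π̃ p < value π̃ q → p ≺ q))
    π̃-spec = rankPermutation n _≺?_ ≺-irrefl ≺-trans ≺-total

    π̃ : Permutation′ n
    π̃ = proj₁ π̃-spec

    letter-< : ∀ p q i j → i < κ → j < κ → letter p < letter q → sample p i < sample q j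
    letter-< p q i j i<κ j<κ lt = /-cancel-< h
      (subst₂ _<_ (sym (level-coarse i (cell p) i<κ)) (sym (level-coarse j (cell q) j<κ)) lt)

    agree : ∀ p q → p < n → q < n → Good p → Good q → coarse p < coarse q →
            value π p < value π q × value π̃ p < value π̃ q
    agree p q p<n q<n gp gq cp<cq =
      /-cancel-< u (/-cancel-< h cp<cq) , proj₁ (proj₂ π̃-spec) p q p<n q<n p≺q
      where
      lt : letter p < letter q
      lt = subst₂ (λ p q → coarse p < coarse q) (sym (fixes p gp)) (sym (fixes q gq)) cp<cq
      p≺q : p ≺ q
      p≺q with <-cmp p q
      ... | tri< p<q _ _  = inj₁ (p<q , letter-< p q 0 1 (<-trans z<s 1<κ) 1<κ lt)
      ... | tri≈ _ refl _ = contradiction cp<cq (<-irrefl refl)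
      ... | tri> _ _ q<p  = inj₂ (q<p , letter-< p q 1 0 1<κ (<-trans z<s 1<κ) lt)

    footrule-π̃ : footrule π π̃ ≤ n * (∑ n (λ p → 𝟙 (¬? (Good? p))) + u * h) + n * ∑ n (λ p → 𝟙 (¬? (Good? p)))
    footrule-π̃ = footrule-≤ π π̃ coarse Good? _ (u * h) 0<n ≤-refl coarse-class≤ agree

    -- A copy of `A` in `π̃` at positions `pos 0 < … < pos (k - 1)`: sample `i` of
    -- the cell of `pos i` gives `k` sets of points of `π` to the right of one
    -- another, on fine levels that form the pattern `A`.
    many-copies : ∀ K → Induces A π̃ K → L ^ k ≤ copies A π
    many-copies K (∣K∣≡k , pattern′) = count-copies A π fine l L lo y
      (λ p q → /-cancel-< u)
      (λ i → within (toℕ i) (cell (pos i)) (i<κ i))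
      (λ i j i<j → ordered (toℕ i) (toℕ j) (cell (pos i)) (cell (pos j))
         (/-monoˡ-≤ node (mono (<⇒≤ (pos-mono i j i<j)))) i<j (i<κ j))
      (λ i → many (toℕ i) (cell (pos i)) (i<κ i))
      y-distinct
      (λ i j → mk⇔ (to i j) (from i j))
      where
      elem : Fin k → Fin n
      elem i = nthSmallest K (cast (sym ∣K∣≡k) i)
      pos : Fin k → ℕ
      pos i = toℕ (elem i)
      i<κ : ∀ (i : Fin k) → toℕ i < κ
      i<κ i = <-≤-trans (Fin.toℕ<n i) (m≤m+n k 4)
      pos-mono : ∀ i j → i Fin.< j → pos i < pos j
      pos-mono i j i<j = nthSmallest-mono K
        (subst₂ _<_ (sym (Fin.toℕ-cast (sym ∣K∣≡k) i)) (sym (Fin.toℕ-cast (sym ∣K∣≡k) j)) i<j)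
      open Increasing pos pos-mono
      lo y : Fin k → ℕ
      lo i = start (column (pos i)) (toℕ i)
      y i  = sample (pos i) (toℕ i)
      y-distinct : ∀ i j → i ≢ j → y i ≢ y j
      y-distinct = <-distinct⇒distinct y λ i j i<j → distinct (toℕ i) (toℕ j) (cell (pos i)) (cell (pos j)) i<j (i<κ j)
      same : ∀ i j → SameOrder (pos i) (pos j) (toℕ i) (toℕ j)
      same i j = reflects i j , reflects j i
      to : ∀ i j → A ⟨$⟩ʳ i Fin.< A ⟨$⟩ʳ j → y i < y j
      to i j Ai<Aj = ≺⇒< (same i j) (i<κ i) (i<κ j)
        (proj₂ (proj₂ π̃-spec) (pos i) (pos j) (Fin.toℕ<n (elem i)) (Fin.toℕ<n (elem j))
          (subst₂ _<_ (sym (value-toℕ π̃ (elem i))) (sym (value-toℕ π̃ (elem j))) (Equivalence.to (pattern′ i j) Ai<Aj)))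
      from : ∀ i j → y i < y j → A ⟨$⟩ʳ i Fin.< A ⟨$⟩ʳ j
      from i j yi<yj = Equivalence.from (pattern′ i j)
        (subst₂ _<_ (value-toℕ π̃ (elem i)) (value-toℕ π̃ (elem j))
          (proj₁ (proj₂ π̃-spec) (pos i) (pos j) (Fin.toℕ<n (elem i)) (Fin.toℕ<n (elem j))
            (<⇒≺ (same i j) (i<κ i) (i<κ j)
              (λ pi≡pj → <⇒≢ yi<yj (cong y (reflects-≡ i j pi≡pj))) yi<yj)))

-- Good positions, constants, and large permutations

module GoodPositions (lt : ℕ → ℕ) (ℓ : ℕ) (lt<ℓ : ∀ p → lt p < ℓ) (g : ℕ) (ram : ℕ → ℕ) (b c W : ℕ)
  (stage : Refinement.Stage lt ℓ lt<ℓ g ram b c W) where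

  open Refinement lt ℓ lt<ℓ g using (lost)
  open Refinement.Stage stage

  -- The length of a node.
  node : ℕ
  node = r * l

  module _ .⦃ _ : NonZero node ⦄ where

    -- The position is covered and its letter is active at its node.
    Good : ℕ → Set
    Good p = p < W × Active (p / node) (lt p)

    abstract
      Good? : ∀ p → Dec (Good p)
      Good? p = (p <? W) ×-dec Active? (p / node) (lt p)

    Good-node : ∀ p → Good p → p / node < M
    Good-node p (p<W , _) = m<n*o⇒m/o<n (<-≤-trans p<W (≤-reflexive (sym covers)))

    -- The `o` positions that no node covers are bad as well.
    few-bad : ∀ n o → W + o ≡ n → c * ∑ n (λ p → 𝟙 (¬? (Good? p))) ≤ 2 * W + c * o
    few-bad n o refl = begin
      c * ∑ (W + o) bad
        ≡⟨ cong (c *_) (∑-split W o bad) ⟩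
      c * (∑ W bad + ∑ o (λ i → bad (W + i)))
        ≤⟨ *-monoʳ-≤ c (+-mono-≤ left right) ⟩
      c * (lost Active? M node + o)
        ≡⟨ *-distribˡ-+ c _ o ⟩
      c * lost Active? M node + c * o
        ≤⟨ +-monoˡ-≤ (c * o) few-lost ⟩
      2 * W + c * o ∎
      where
      open ≤-Reasoning
      bad inactive : ℕ → ℕ
      bad p      = 𝟙 (¬? (Good? p))
      inactive p = 𝟙 (¬? (Active? (p / node) (lt p)))
      right : ∑ o (λ i → bad (W + i)) ≤ o
      right = ≤-trans (∑-≤-const o λ i _ → 𝟙≤1 (¬? (Good? (W + i)))) (≤-reflexive (*-identityʳ o))
      left : ∑ W bad ≤ lost Active? M node
      left = begin
        ∑ W bad                                             ≤⟨ ∑-mono W (λ p p<W → 𝟙-mono (¬? (Good? p)) (¬? (Active? (p / node) (lt p))) λ ¬good act → ¬good (p<W , act)) ⟩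
        ∑ W inactive                                        ≡⟨ cong (λ z → ∑ z inactive) covers ⟨
        ∑ (M * node) inactive                               ≡⟨ ∑-blocks M node inactive ⟩
        ∑ M (λ J → ∑ node (λ i → inactive (J * node + i)))  ≡⟨ ∑-cong M (λ J _ → ∑-cong node λ i i<node → cong (λ v → 𝟙 (¬? (Active? v (lt (J * node + i))))) ([J*l+i]/l≡J J i<node)) ⟩
        lost Active? M node                                 ∎

-- The constants of the construction, for patterns of size `k` and the reciprocal
-- `e` of the error.  They are characterised by equations, so that the proofs
-- never compute them.  With the unit length `L = n / Z`:
--   `m` coarse levels cover all values but a short rest, so `ℓ` letters suffice;
--   `c` bounds errors: quantities below one or two parts in `c` are negligible;
--   `T` is the number of refinements that exhausts the potential;
--   `g` is the reciprocal of the density below which a letter is discarded;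
--   `Q` is the number of leaf blocks, each of length `y * L`;
--   `N` bounds the number of pairs of a cell and a selected child, for which
--   distinct fine levels are chosen;
--   `x * L` is the width of a fine level, and `h` fine levels form a coarse one,
--   so many that a dense letter meets more than `N` of them substantially;
--   `Z` is the total number of units in the leaf blocks.
record Constants (k e : ℕ) : Set where
  field
    m ℓ c T g Q N x h y Z : ℕ
    m≡ : m ≡ 4 * e
    ℓ≡ : ℓ ≡ suc m
    c≡ : c ≡ 16 * e
    T≡ : T ≡ suc (c * (2 * ℓ))
    g≡ : g ≡ c * (T * ℓ)
    Q≡ : Q ≡ leaves (arity ℓ (k + 4)) 1 T
    N≡ : N ≡ Q * ℓ
    x≡ : x ≡ 2 * g * Q
    h≡ : h ≡ N * x + 2
    y≡ : y ≡ 2 * g * (m * h)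
    Z≡ : Z ≡ Q * y

  -- Permutations of at least this size are treated as large.
  n₀ : ℕ
  n₀ = c * (Z * Z)

constants : ∀ k e → Constants k e
constants k e = record
  { m≡ = refl ; ℓ≡ = refl ; c≡ = refl ; T≡ = refl ; g≡ = refl ; Q≡ = refl
  ; N≡ = refl ; x≡ = refl ; h≡ = refl ; y≡ = refl ; Z≡ = refl }

-- The construction for `n` of size at least `n₀`.
module LargeCase {k n : ℕ} (A : Permutation′ k) (π : Permutation′ n) {e : ℕ} .⦃ _ : NonZero e ⦄
  (C : Constants k e) (n-large : Constants.n₀ C ≤ n) where

  open Constants C

  private
    nz : ∀ {a b} → a ≡ b → NonZero b → NonZero a
    nz refl b≢0 = b≢0

  arity≢0 : ∀ M → NonZero (arity ℓ (k + 4) M)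
  arity≢0 M = ramseyNumber≢0 (length (pairsOfCells ℓ M)) (k + 4) ⦃ >-nonZero (≤-trans z<s (m≤n+m 4 k)) ⦄

  instance
    m≢0 : NonZero m
    m≢0 = nz m≡ (m*n≢0 4 e)
    ℓ≢0 : NonZero ℓ
    ℓ≢0 = nz ℓ≡ _
    c≢0 : NonZero c
    c≢0 = nz c≡ (m*n≢0 16 e)
    Q≢0 : NonZero Q
    Q≢0 = nz Q≡ (leaves≢0 arity≢0 1 T)
    T≢0 : NonZero T
    T≢0 = nz T≡ _
    Tℓ≢0 : NonZero (T * ℓ)
    Tℓ≢0 = m*n≢0 T ℓ
    g≢0 : NonZero g
    g≢0 = nz g≡ (m*n≢0 c (T * ℓ))
    2g≢0 : NonZero (2 * g)
    2g≢0 = m*n≢0 2 g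
    x≢0 : NonZero x
    x≢0 = nz x≡ (m*n≢0 (2 * g) Q)
    h≢0 : NonZero h
    h≢0 = nz h≡ (>-nonZero (≤-trans z<s (m≤n+m 2 (N * x))))
    mh≢0 : NonZero (m * h)
    mh≢0 = m*n≢0 m h
    y≢0 : NonZero y
    y≢0 = nz y≡ (m*n≢0 (2 * g) (m * h))
    Z≢0 : NonZero Z
    Z≢0 = nz Z≡ (m*n≢0 Q y)

  -- The unit, the width of a fine level, the length of a leaf block, and the
  -- number of positions covered by the blocks.
  L u b W : ℕ
  L = n / Z
  u = x * L
  b = y * L
  W = Q * b

  cZ*Z≤n : c * Z * Z ≤ n
  cZ*Z≤n = ≤-trans (≤-reflexive (*-assoc c Z Z)) n-large

  cZ≤L : c * Z ≤ L
  cZ≤L = ≤-trans (≤-reflexive (sym (m*n/n≡m (c * Z) Z))) (/-monoˡ-≤ Z cZ*Z≤n)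

  Z≤L : Z ≤ L
  Z≤L = ≤-trans (m≤n*m Z c) cZ≤L

  n≤c*Z*Z*L : n ≤ c * (Z * Z) * L
  n≤c*Z*Z*L = begin
    n                     ≡⟨ m≡m%n+[m/n]*n n Z ⟩
    n % Z + L * Z         ≤⟨ +-mono-≤ (≤-trans (m%n≤n n Z) (m≤n*m Z L ⦃ >-nonZero (<-≤-trans (>-nonZero⁻¹ Z) Z≤L) ⦄)) ≤-refl ⟩
    L * Z + L * Z         ≡⟨ cong (L * Z +_) (+-identityʳ (L * Z)) ⟨
    2 * (L * Z)           ≤⟨ *-monoˡ-≤ (L * Z) (≤-trans 2≤c (m≤m*n c Z)) ⟩
    c * Z * (L * Z)       ≡⟨ rearr c Z L ⟩
    c * (Z * Z) * L       ∎
    where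
    open ≤-Reasoning
    rearr : ∀ c Z L → c * Z * (L * Z) ≡ c * (Z * Z) * L
    rearr = solve-∀
    2≤c : 2 ≤ c
    2≤c = ≤-trans (≤-trans (m≤m+n 2 14) (m≤m*n 16 e)) (≤-reflexive (sym c≡))

  instance
    L≢0 : NonZero L
    L≢0 = >-nonZero (<-≤-trans (>-nonZero⁻¹ Z) Z≤L)
    u≢0 : NonZero u
    u≢0 = m*n≢0 x L
    b≢0 : NonZero b
    b≢0 = m*n≢0 y L

  W≡ : W ≡ L * Z
  W≡ = trans (sym (*-assoc Q y L)) (trans (cong (_* L) (sym Z≡)) (*-comm Z L))

  W+rem≡n : W + n % Z ≡ n
  W+rem≡n = trans (cong (_+ n % Z) W≡) (trans (+-comm (L * Z) _) (sym (m≡m%n+[m/n]*n n Z)))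

  W≤n : W ≤ n
  W≤n = ≤-trans (m≤m+n W (n % Z)) (≤-reflexive W+rem≡n)

  0<W : 0 < W
  0<W = >-nonZero⁻¹ W ⦃ m*n≢0 Q b ⦄

  0<n : 0 < n
  0<n = <-≤-trans 0<W W≤n

  W≡mhu : W ≡ m * h * u
  W≡mhu = begin
    Q * (y * L)                       ≡⟨ cong (λ y → Q * (y * L)) y≡ ⟩
    Q * (2 * g * (m * h) * L)         ≡⟨ rearr Q g (m * h) L ⟩
    m * h * (2 * g * Q * L)           ≡⟨ cong (λ x → m * h * (x * L)) x≡ ⟨
    m * h * (x * L)                   ∎
    where
    open ≡-Reasoning
    rearr : ∀ Q g mh L → Q * (2 * g * mh * L) ≡ mh * (2 * g * Q * L)
    rearr = solve-∀

  n≤levels : n ≤ suc (m * h) * u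
  n≤levels = begin
    n                     ≡⟨ W+rem≡n ⟨
    W + n % Z             ≤⟨ +-mono-≤ (≤-reflexive W≡mhu) (≤-trans (m%n≤n n Z) (≤-trans Z≤L (m≤n*m L x))) ⟩
    m * h * u + u         ≡⟨ +-comm (m * h * u) u ⟩
    suc (m * h) * u       ∎
    where open ≤-Reasoning

  open Rearrangement A π 0<n u h L

  fine<levels : ∀ p → fine p < suc (m * h)
  fine<levels p = m<n*o⇒m/o<n {n = suc (m * h)} {o = u} (<-≤-trans (value-< π p 0<n) n≤levels)

  coarse<ℓ : ∀ p → fine p / h < ℓ
  coarse<ℓ p = m<n*o⇒m/o<n {n = ℓ} {o = h} (<-≤-trans (fine<levels p) (begin
    suc (m * h)     ≤⟨ +-monoˡ-≤ (m * h) (>-nonZero⁻¹ h) ⟩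
    h + m * h       ≡⟨ cong (_* h) ℓ≡ ⟨
    ℓ * h           ∎))
    where open ≤-Reasoning

  b-large : g * (N * u + suc (m * h) * L) < b
  b-large = begin-strict
    g * (N * (x * L) + suc (m * h) * L)     ≡⟨ collect g N x L (m * h) ⟩
    g * L * (suc (N * x) + m * h)           <⟨ *-monoʳ-< (g * L) ⦃ m*n≢0 g L ⦄ (+-monoˡ-< (m * h) Nx+1<mh) ⟩
    g * L * (m * h + m * h)                 ≡⟨ double g L (m * h) ⟩
    2 * g * (m * h) * L                     ≡⟨ cong (_* L) y≡ ⟨
    y * L                                   ∎
    where
    open ≤-Reasoning
    collect : ∀ g N x L mh → g * (N * (x * L) + suc mh * L) ≡ g * L * (suc (N * x) + mh)
    collect = solve-∀
    double : ∀ g L mh → g * L * (mh + mh) ≡ 2 * g * mh * L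
    double = solve-∀
    Nx+1<mh : suc (N * x) < m * h
    Nx+1<mh = ≤-trans (≤-reflexive (trans (+-comm 2 (N * x)) (sym h≡))) (m≤n*m h m)

  Stage′ : Set₁
  Stage′ = Refinement.Stage coarse ℓ coarse<ℓ g (arity ℓ κ) b c W

  stage : Stage′
  stage = Refinement.stage-exists coarse ℓ coarse<ℓ g (arity ℓ κ) arity≢0 b c W T g≡
            (cong (_* b) Q≡) (≤-reflexive (sym T≡)) 0<W

  -- A permutation close to `π` which has no copy of `A` unless `π` has many.
  Result : Set
  Result = Σ[ π̃ ∈ Permutation′ n ]
    ((∀ K → Induces A π̃ K → L ^ k ≤ copies A π) × e * footrule π π̃ < n * n)

  module _ (stage : Stage′) where

    open Refinement.Stage stage
    open GoodPositions coarse ℓ coarse<ℓ g (arity ℓ κ) b c W stage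

    instance
      l≢0 : NonZero l
      l≢0 = >-nonZero (<-≤-trans (>-nonZero⁻¹ b) b≤l)
      r≢0 : NonZero r
      r≢0 = m*n≢0 2 ρ ⦃ _ ⦄ ⦃ arity≢0 M ⦄
      node≢0 : NonZero node
      node≢0 = m*n≢0 r l

    cells≤N : M * (ℓ * ρ) ≤ N
    cells≤N = begin
      M * (ℓ * ρ)    ≡⟨ rearr M ℓ ρ ⟩
      M * ρ * ℓ      ≤⟨ *-monoˡ-≤ ℓ (≤-trans (*-monoʳ-≤ M (m≤n*m ρ 2)) Mr≤Q) ⟩
      Q * ℓ          ≡⟨ N≡ ⟨
      N              ∎
      where
      open ≤-Reasoning
      rearr : ∀ M ℓ ρ → M * (ℓ * ρ) ≡ M * ρ * ℓ
      rearr = solve-∀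
      Mr≤Q : M * r ≤ Q
      Mr≤Q = *-cancelʳ-≤ (M * r) Q l (begin
        M * r * l     ≡⟨ *-assoc M r l ⟩
        M * (r * l)   ≡⟨ covers ⟩
        Q * b         ≤⟨ *-monoʳ-≤ Q b≤l ⟩
        Q * l         ∎)

    -- The number of bad positions.
    #bad : ℕ
    #bad = ∑ n (λ p → 𝟙 (¬? (Good? p)))

    c*#bad≤3n : c * #bad ≤ 3 * n
    c*#bad≤3n = begin
      c * #bad                ≤⟨ few-bad n (n % Z) W+rem≡n ⟩
      2 * W + c * (n % Z)     ≤⟨ +-mono-≤ (*-monoʳ-≤ 2 W≤n) (≤-trans (*-monoʳ-≤ c (m%n≤n n Z)) (≤-trans (m≤m*n (c * Z) Z) cZ*Z≤n)) ⟩
      2 * n + n               ≡⟨ +-comm (2 * n) n ⟩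
      3 * n                   ∎
      where open ≤-Reasoning

    -- Of sixteen parts of the allowance, each of the two terms with `#bad` takes at
    -- most three and the width of the coarse levels takes at most four.
    e*footrule< : ∀ F → F ≤ n * (#bad + u * h) + n * #bad → e * F < n * n
    e*footrule< F F≤ = *-cancelˡ-< 16 _ _ (begin-strict
      16 * (e * F)                                          ≤⟨ *-monoʳ-≤ 16 (*-monoʳ-≤ e F≤) ⟩
      16 * (e * (n * (#bad + u * h) + n * #bad))            ≡⟨ expand e n #bad (u * h) ⟩
      n * (2 * (16 * e * #bad) + 4 * (4 * e * (u * h)))     ≡⟨ cong₂ (λ c m → n * (2 * (c * #bad) + 4 * (m * (u * h)))) c≡ m≡ ⟨
      n * (2 * (c * #bad) + 4 * (m * (u * h)))              ≤⟨ *-monoʳ-≤ n (+-mono-≤ (*-monoʳ-≤ 2 c*#bad≤3n) (*-monoʳ-≤ 4 coarse≤n)) ⟩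
      n * (2 * (3 * n) + 4 * n)                             ≡⟨ total n ⟩
      10 * (n * n)                                          <⟨ *-monoˡ-< (n * n) ⦃ m*n≢0 n n ⦃ >-nonZero 0<n ⦄ ⦃ >-nonZero 0<n ⦄ ⦄ (m≤m+n 11 5) ⟩
      16 * (n * n)                                          ∎)
      where
      open ≤-Reasoning
      expand : ∀ e n B w → 16 * (e * (n * (B + w) + n * B)) ≡ n * (2 * (16 * e * B) + 4 * (4 * e * w))
      expand = solve-∀
      total : ∀ n → n * (2 * (3 * n) + 4 * n) ≡ 10 * (n * n)
      total = solve-∀
      reorder : ∀ m u h → m * (u * h) ≡ m * h * u
      reorder = solve-∀
      coarse≤n : m * (u * h) ≤ n
      coarse≤n = ≤-trans (≤-reflexive (trans (reorder m u h) (sym W≡mhu))) W≤n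

    some-good : ∃[ p ] Good p
    some-good = ∑-exists n Good? (*-cancelˡ-< 16 #bad n (begin-strict
      16 * #bad      ≤⟨ *-monoˡ-≤ #bad (≤-trans (m≤m*n 16 e) (≤-reflexive (sym c≡))) ⟩
      c * #bad       ≤⟨ c*#bad≤3n ⟩
      3 * n          <⟨ *-monoˡ-< n ⦃ >-nonZero 0<n ⦄ (m≤m+n 4 12) ⟩
      16 * n         ∎))
      where open ≤-Reasoning

    open Levels n fine h u (suc (m * h)) L N g b fine<levels class≤u b-large using (Cell; template)

    Cell′ : ℕ → ℕ → Set
    Cell′ = Cell ℓ coarse<ℓ κ c W W≤n stage

    rearranged : Template κ Cell′ → Result
    rearranged template =
      let z , good-z , least-z = least Good? (proj₁ some-good) (proj₂ some-good)
          good-cell : ∀ p → Good p → Cell′ (p / node) (coarse p)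
          good-cell p good = Good-node p good , coarse<ℓ p , proj₂ good
      in  π̃ template node Good? good-cell good-z least-z
        , many-copies template node Good? good-cell good-z least-z
        , e*footrule< _ (footrule-π̃ template node Good? good-cell good-z least-z)

    rearrangement : Result
    rearrangement = rearranged (template ℓ coarse<ℓ κ c W W≤n stage cells≤N)

-- A large `π` is close to a permutation `π̃` such that, if `π̃` has any copy of `A`,
-- then `π` has at least `L ^ k` copies, for an `L` proportional to `n`.
rearrangement-exists : ∀ {k n} (A : Permutation′ k) (π : Permutation′ n) {e} .⦃ _ : NonZero e ⦄
  (consts : Constants k e) → Constants.n₀ consts ≤ n →
  Σ[ L ∈ ℕ ] (n ≤ Constants.n₀ consts * L × Σ[ π̃ ∈ Permutation′ n ]
    ((∀ K → Induces A π̃ K → L ^ k ≤ copies A π) × e * footrule π π̃ < n * n))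
rearrangement-exists A π consts n-large = L , n≤c*Z*Z*L , rearrangement stage
  where open LargeCase A π consts n-large

-- The removal lemma

nCk≤n^k : ∀ n k → n C k ≤ n ^ k
nCk≤n^k n       zero    = ≤-refl
nCk≤n^k zero    (suc k) = ≤-reflexive (k>n⇒nCk≡0 {0} {suc k} z<s)
nCk≤n^k (suc n) (suc k) = begin
  suc n C suc k           ≡⟨ nCk+nC[k+1]≡[n+1]C[k+1] n k ⟨
  n C k + n C suc k       ≤⟨ +-mono-≤ (nCk≤n^k n k) (nCk≤n^k n (suc k)) ⟩
  suc n * n ^ k           ≤⟨ *-monoʳ-≤ (suc n) (^-monoˡ-≤ k (n≤1+n n)) ⟩
  suc n ^ suc k           ∎
  where open ≤-Reasoning

^-distribʳ-* : ∀ k m n → (m * n) ^ k ≡ m ^ k * n ^ k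
^-distribʳ-* zero    m n = refl
^-distribʳ-* (suc k) m n = trans (cong (m * n *_) (^-distribʳ-* k m n)) (regroup m n (m ^ k) (n ^ k))
  where
  regroup : ∀ m n a b → m * n * (a * b) ≡ m * a * (n * b)
  regroup = solve-∀

no-copies : ∀ {k n} (A : Permutation′ k) (π : Permutation′ n) → (∀ K → ¬ Induces A π K) → copies A π ≡ 0
no-copies A π none = cong length (filter-none (induces? A π) (All.universal none (subsets _)))

footrule-refl : ∀ {n} (π : Permutation′ n) → footrule π π ≡ 0
footrule-refl {n} π = trans (footrule-∑ π π)
  (trans (∑-cong n λ p _ → ∣n-n∣≡0 (value π p)) (trans (∑-const n 0) (*-zeroʳ n)))

-- The removal lemma in natural numbers: `E` is the reciprocal of the density
-- threshold and `e` that of the error.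
module Removal {k e : ℕ} (A : Permutation′ k) .⦃ _ : NonZero e ⦄ (constants : Constants k e) where

  open Constants constants using (n₀)

  -- The successor makes the density of a single copy exceed the threshold when
  -- `n` is at most `n₀`.
  E : ℕ
  E = suc (n₀ ^ k)

  -- A permutation without copies of `A` at small distance exists.
  Modified : ∀ {n} → Permutation′ n → Set
  Modified {n} π = Σ[ π̃ ∈ Permutation′ n ] (copies A π̃ ≡ 0 × e * footrule π π̃ < n * n)

  modify-small : ∀ n → k ≤ n → (π : Permutation′ n) → n ≤ n₀ → copies A π * E < n C k → Modified π
  modify-small n k≤n π n≤n₀ few =
    π , none , subst (_< n * n) (sym (trans (cong (e *_) (footrule-refl π)) (*-zeroʳ e))) (nonempty n k≤n π none)
    where
    below-one : ∀ d → d * E < n C k → d ≡ 0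
    below-one zero    _   = refl
    below-one (suc d) few = contradiction few (≤⇒≯ (begin
      n C k             ≤⟨ nCk≤n^k n k ⟩
      n ^ k             ≤⟨ ^-monoˡ-≤ k n≤n₀ ⟩
      n₀ ^ k            ≤⟨ n≤1+n (n₀ ^ k) ⟩
      E                 ≤⟨ m≤m+n E (d * E) ⟩
      suc d * E         ∎))
      where open ≤-Reasoning
    none : copies A π ≡ 0
    none = below-one (copies A π) few
    -- The empty permutation contains the empty pattern.
    nonempty : ∀ {k} {A : Permutation′ k} n → k ≤ n → (π : Permutation′ n) → copies A π ≡ 0 → 0 < n * n
    nonempty             (suc n) _   π _    = z<s
    nonempty {A = A}     zero    z≤n π none =
      contradiction (trans (sym (cong length (filter-accept (induces? A π) {x = []} {xs = []} (refl , λ ())))) none) λ ()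

  modify-large : ∀ n (π : Permutation′ n) → n₀ ≤ n → copies A π * E < n C k → Modified π
  modify-large n π n₀≤n few =
    let L , n≤n₀L , π̃ , copied , small = rearrangement-exists A π constants n₀≤n
    in  π̃ , no-copies A π̃ (λ K ind → <⇒≱ few (begin
      n C k                     ≤⟨ nCk≤n^k n k ⟩
      n ^ k                     ≤⟨ ^-monoˡ-≤ k n≤n₀L ⟩
      (n₀ * L) ^ k              ≡⟨ ^-distribʳ-* k n₀ L ⟩
      n₀ ^ k * L ^ k            ≤⟨ *-mono-≤ (n≤1+n (n₀ ^ k)) (copied K ind) ⟩
      E * copies A π            ≡⟨ *-comm E _ ⟩
      copies A π * E            ∎)) , small
    where open ≤-Reasoning

  modify : ∀ n → k ≤ n → (π : Permutation′ n) → copies A π * E < n C k → Modified π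
  modify n k≤n π few with ≤-total n₀ n
  ... | inj₁ n₀≤n = modify-large n π n₀≤n few
  ... | inj₂ n≤n₀ = modify-small n k≤n π n≤n₀ few

fraction-< : ∀ a b c d .⦃ _ : NonZero b ⦄ .⦃ _ : NonZero d ⦄ →
             ℤ.+ a ℚ./ b ℚ.< ℤ.+ c ℚ./ d → a * d < c * b
fraction-< a (suc b) c (suc d) lt =
  ℤ.drop‿+<+ (subst₂ ℤ._<_ (sym (ℤ.pos-* a (suc d))) (sym (ℤ.pos-* c (suc b))) (ℚᵘ.drop-*<*
    (ℚᵘ.<-respˡ-≃ (ℚ.toℚᵘ-fromℚᵘ (mkℚᵘ (ℤ.+ a) b)) (ℚᵘ.<-respʳ-≃ (ℚ.toℚᵘ-fromℚᵘ (mkℚᵘ (ℤ.+ c) d)) (ℚ.toℚᵘ-mono-< lt)))))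

-- This rests on `ε` being at least the reciprocal of its denominator.
fromℕ-< : ∀ ε → 0ℚ ℚ.< ε → ∀ F G → ℚ.↧ₙ ε * F < G → fromℕ F ℚ.< ε ℚ.* fromℕ G
fromℕ-< (mkℚ (ℤ.+ zero) d _) 0<ε F G lt = contradiction (ℚ.drop-*<* 0<ε) λ { (ℤ.+<+ ()) }
fromℕ-< (mkℚ ℤ.-[1+ a ] d _) 0<ε F G lt = contradiction (ℚ.drop-*<* 0<ε) λ ()
fromℕ-< ε@(mkℚ ℤ.+[1+ a ] d _) 0<ε F G lt = ℚ.toℚᵘ-cancel-< (begin-strict
  toℚᵘ (fromℕ F)               ≃⟨ ℚ.toℚᵘ-fromℚᵘ (mkℚᵘ (ℤ.+ F) 0) ⟩
  mkℚᵘ (ℤ.+ F) 0               <⟨ ℚᵘ.*<* cross ⟩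
  toℚᵘ ε ℚᵘ.* mkℚᵘ (ℤ.+ G) 0   ≃⟨ ℚᵘ.*-congˡ {toℚᵘ ε} (ℚ.toℚᵘ-fromℚᵘ (mkℚᵘ (ℤ.+ G) 0)) ⟨
  toℚᵘ ε ℚᵘ.* toℚᵘ (fromℕ G)   ≃⟨ ℚ.toℚᵘ-homo-* ε (fromℕ G) ⟨
  toℚᵘ (ε ℚ.* fromℕ G)         ∎)
  where
  open ℚᵘ.≤-Reasoning
  F<G : F * (suc d * 1) < suc a * G * 1
  F<G = subst₂ _<_ (trans (*-comm (suc d) F) (cong (F *_) (sym (*-identityʳ (suc d))))) (sym (*-identityʳ (suc a * G)))
    (<-≤-trans lt (m≤m+n G (a * G)))
  cross : ℤ.+ F ℤ.* ℤ.+ (suc d * 1) ℤ.< (ℤ.+[1+ a ] ℤ.* ℤ.+ G) ℤ.* ℤ.+ 1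
  cross = subst₂ ℤ._<_ (ℤ.pos-* F (suc d * 1))
    (trans (ℤ.pos-* (suc a * G) 1) (cong (ℤ._* ℤ.+ 1) (ℤ.pos-* (suc a) G))) (ℤ.+<+ F<G)

theorem1p2 :
    (k : ℕ) (A : Permutation′ k) (ε : ℚ) → 0ℚ ℚ.< ε →
    Σ[ δ ∈ ℚ ] (0ℚ ℚ.< δ ×
      ((n : ℕ) (k≤n : k ≤ n) (π : Permutation′ n) → density A π k≤n ℚ.< δ →
        Σ[ π̃ ∈ Permutation′ n ]
          (Avoids A π̃ k≤n × fromℕ (footrule π π̃) ℚ.< ε ℚ.* fromℕ (n ^ 2))))
theorem1p2 k A ε 0<ε = conclude (constants k (ℚ.↧ₙ ε))
  where
  conclude : Constants k (ℚ.↧ₙ ε) →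
    Σ[ δ ∈ ℚ ] (0ℚ ℚ.< δ ×
      ((n : ℕ) (k≤n : k ≤ n) (π : Permutation′ n) → density A π k≤n ℚ.< δ →
        Σ[ π̃ ∈ Permutation′ n ]
          (Avoids A π̃ k≤n × fromℕ (footrule π π̃) ℚ.< ε ℚ.* fromℕ (n ^ 2))))
  conclude consts = ℤ.+ 1 ℚ./ E , ℚ.positive⁻¹ _ ⦃ ℚ.normalize-pos 1 E ⦄ , λ n k≤n π sparse →
    let instance nonZero = >-nonZero (nCk>0 k≤n)
        π̃ , none , small = modify n k≤n π
          (<-≤-trans (fraction-< (copies A π) (n C k) 1 E sparse) (≤-reflexive (*-identityˡ (n C k))))
    in  π̃
      , trans (cong (λ d → ℤ.+ d ℚ./ (n C k)) none) (ℚ.0/n≡0 (n C k))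
      , fromℕ-< ε 0<ε (footrule π π̃) (n ^ 2)
          (<-≤-trans small (≤-reflexive (cong (n *_) (sym (*-identityʳ n)))))
    where open Removal A consts
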